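{- Let $p$ be a prime, let $n\geq p^2$ and let $D\subseteq\mathbb{F}_p^n$ be a set with $|D|<\binom{n+p-2}{p-1}$. Then there exist disjoint sets $T_1,T_2\subseteq\mathbb{F}_p^n$ such that the $p$-dimensional rectangle $T_1\times T_2\times\cdots\times T_2$ contains at least $p^{2n+p-p^2}$ lines, but contains no line with direction in $D$.
   Context: Identify $\mathbb{F}_p$ with $\{0,1,\dots,p-1\}$. The line through $x\in\mathbb{F}_p^n$ in direction $d\in\mathbb{F}_p^n$ is the sequence $\ell_{x,d}=(x+\lambda d)_{\lambda\in\mathbb{F}_p}$; a rectangle $T'_1\times\cdots\times T'_p$ contains $\ell_{x,d}$ if $x+\lambda d\in T'_{\lambda+1}$ for every $\lambda\in\{0,\dots,p-1\}$. Lines are counted as pairs $(x,d)\in\mathbb{F}_p^n\times\mathbb{F}_p^n$ with $\ell_{x,d}$ contained in the rectangle. -}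

module Defs where

open import Data.Nat using (ℕ; zero; suc; _+_; _*_; NonZero)
open import Data.Nat.DivMod using (_%_; m%n<n)
open import Data.Fin using (Fin; toℕ; fromℕ<) renaming (zero to fzero; suc to fsuc)
open import Data.Vec using (Vec; []; _∷_; zipWith)
import Data.Vec as V
open import Data.Bool using (Bool; true; false; _∧_; not; if_then_else_)
open import Data.List using (List; [_]; concatMap; allFin; length; filterᵇ; cartesianProduct)
import Data.List as L
open import Data.Product using (_×_; _,_; uncurry)

addF : (p : ℕ) .{{_ : NonZero p}} → Fin p → Fin p → Fin p
addF p x y = fromℕ< (m%n<n (toℕ x + toℕ y) p)

mulF : (p : ℕ) .{{_ : NonZero p}} → Fin p → Fin p → Fin p
mulF p x y = fromℕ< (m%n<n (toℕ x * toℕ y) p)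

Pt : ℕ → ℕ → Set
Pt p n = Vec (Fin p) n

pointOnLine : (p : ℕ) .{{_ : NonZero p}} {n : ℕ} → Pt p n → Fin p → Pt p n → Pt p n
pointOnLine p x λ' d = zipWith (addF p) x (V.map (mulF p λ') d)

allᵇ : {A : Set} → (A → Bool) → List A → Bool
allᵇ f List.[] = true
allᵇ f (x List.∷ xs) = f x ∧ allᵇ f xs

Subset : ℕ → ℕ → Set
Subset p n = Pt p n → Bool

-- A p-dimensional rectangle T'_1 × ⋯ × T'_p, indexed by Fin p
-- (index i : Fin p corresponds to the factor T'_{i+1}).
Rectangle : ℕ → ℕ → Set
Rectangle p n = Fin p → Subset p n

containsLine : (p : ℕ) .{{_ : NonZero p}} {n : ℕ} → Rectangle p n → Pt p n → Pt p n → Bool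
containsLine p R x d = allᵇ (λ λ' → R λ' (pointOnLine p x λ' d)) (allFin p)

allPts : (p n : ℕ) → List (Pt p n)
allPts p zero = [ [] ]
allPts p (suc n) = concatMap (λ i → L.map (i ∷_) (allPts p n)) (allFin p)

card : (p n : ℕ) → Subset p n → ℕ
card p n S = length (filterᵇ S (allPts p n))

-- Number of lines, i.e. of pairs (x , d) ∈ F_p^n × F_p^n, contained in the rectangle.
lineCount : (p : ℕ) .{{_ : NonZero p}} (n : ℕ) → Rectangle p n → ℕ
lineCount p n R =
  length (filterᵇ (uncurry (containsLine p R)) (cartesianProduct (allPts p n) (allPts p n)))

rect12 : {p n : ℕ} → Subset p n → Subset p n → Rectangle p n
rect12 T₁ T₂ fzero = T₁
rect12 T₁ T₂ (fsuc _) = T₂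

{-# OPTIONS --safe #-}

-- The forms of degree p - 1 in n variables span a space of dimension C(n + p - 2, p - 1) > |D|,
-- so some form f of this degree vanishes on D but has a value c = f(v) ≠ 0. Take T₁ = {f = 0}
-- and T₂ = {f = c}. As deg f = p - 1, the sum of f(x + λd) over λ does not depend on x, and it
-- is 0 for x = 0 and f(d) = 0; along a line in T₁ × T₂ × ⋯ × T₂ it is (p - 1) c ≠ 0.
--
-- The rectangle contains the line λ ↦ λv, since f(λv) = λ^(p-1) f(v). The lines in it are the
-- points (x , d) where the product over λ of 1 - (f(x + λd) - c_λ)^(p-1) is nonzero, with c₀ = 0
-- and c_λ = c otherwise. This product has degree at most D = p (p - 1)², and a function of
-- degree ≤ D on F_p^N that is not 0 is nonzero at p^(N - D/(p-1)) or more points.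
--
-- Degrees are measured by iterated differences of functions ℕ^N → ℤ modulo p. Everything rests
-- on the fact that summation over p consecutive values of one coordinate lowers this degree by
-- p - 1.
module Submission where

open import Defs
open import Data.Bool using (Bool; true; false; not)
import Data.Bool.Properties as Bool
open import Data.Fin as Fin using (Fin; toℕ; fromℕ<; _↑ˡ_; _↑ʳ_; finToFun; funToFin)
import Data.Fin.Properties as Fin
import Data.Integer.DivMod as ℤ
open import Data.Integer.Divisibility.Signed
import Data.Integer.Properties as ℤ
open import Data.Integer.Tactic.RingSolver using (solve-∀)
open import Data.List using
  (List; []; _∷_; _++_; map; length; lookup; filter; filterᵇ; concatMap; allFin; cartesianProduct)
open import Data.List.Membership.Propositional using (_∈_)
open import Data.List.Membership.Propositional.Properties
  using (∈-allFin; ∈-filter⁺; ∈-filter⁻; ∈-map⁺; ∈-concatMap⁺)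
import Data.List.Properties as L
import Data.List.Relation.Unary.Any as Any
open import Data.List.Relation.Unary.Any using (here; there)
open import Data.List.Relation.Unary.Any.Properties using (lookup-index)
open import Data.Nat as ℕ using (ℕ; zero; suc; z≤n; s≤s)
open import Data.Nat.Combinatorics using (_C_; nCn≡1; nCk+nC[k+1]≡[n+1]C[k+1])
import Data.Nat.Divisibility as ℕ
open import Data.Nat.ListAction using (sum)
open import Data.Nat.ListAction.Properties using (sum-++)
open import Data.Nat.Primality using (Prime; euclidsLemma; prime⇒nonTrivial)
import Data.Nat.Properties as ℕ
open import Data.Nat.Tactic.RingSolver using () renaming (solve-∀ to solveℕ-∀)
open import Data.Product using (Σ; ∃; _×_; _,_; proj₂; uncurry)
open import Data.Sum using (_⊎_; inj₁; inj₂)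
open import Data.Vec as V using (Vec; []; _∷_; zipWith; replicate)
import Data.Vec.Properties as V
open import Data.Vec.Relation.Binary.Pointwise.Inductive using (Pointwise; []; _∷_)
open import Function using (_∘_; Equivalence)
open import Relation.Binary.Bundles using (Setoid)
open import Relation.Binary.PropositionalEquality
  using (_≡_; _≢_; refl; sym; trans; cong; cong₂; subst; module ≡-Reasoning)
import Relation.Binary.Reasoning.Setoid as SetoidReasoning
open import Relation.Nullary using (¬_; Dec; yes; no; contradiction; ¬?)
open import Relation.Nullary.Decidable using (⌊_⌋; map′)

-- Counting points and vectors

length-filterᵇ-map : ∀ {A B : Set} (S : B → Bool) (f : A → B) xs →
  length (filterᵇ S (map f xs)) ≡ length (filterᵇ (S ∘ f) xs)
length-filterᵇ-map S f [] = refl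
length-filterᵇ-map S f (x ∷ xs) with S (f x)
... | true  = cong suc (length-filterᵇ-map S f xs)
... | false = length-filterᵇ-map S f xs

length-filterᵇ-++ : ∀ {A : Set} (S : A → Bool) xs ys →
  length (filterᵇ S (xs ++ ys)) ≡ length (filterᵇ S xs) ℕ.+ length (filterᵇ S ys)
length-filterᵇ-++ S [] ys = refl
length-filterᵇ-++ S (x ∷ xs) ys with S x
... | true  = cong suc (length-filterᵇ-++ S xs ys)
... | false = length-filterᵇ-++ S xs ys

length-filterᵇ-mono : ∀ {A : Set} {S T : A → Bool} → (∀ x → S x ≡ true → T x ≡ true) →
  ∀ xs → length (filterᵇ S xs) ℕ.≤ length (filterᵇ T xs)
length-filterᵇ-mono S⊆T [] = z≤n
length-filterᵇ-mono {S = S} {T} S⊆T (x ∷ xs) with S x in Sx | T x in Tx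
... | true  | true  = s≤s (length-filterᵇ-mono S⊆T xs)
... | false | true  = ℕ.m≤n⇒m≤1+n (length-filterᵇ-mono S⊆T xs)
... | false | false = length-filterᵇ-mono S⊆T xs
... | true  | false with () ← trans (sym Tx) (S⊆T x Sx)

card-mono : ∀ {p n} {S T : Subset p n} → (∀ x → S x ≡ true → T x ≡ true) → card p n S ℕ.≤ card p n T
card-mono {p} {n} S⊆T = length-filterᵇ-mono S⊆T (allPts p n)

card-suc : ∀ {p n} (S : Subset p (suc n)) →
  card p (suc n) S ≡ sum (map (λ i → card p n (S ∘ (i ∷_))) (allFin p))
card-suc {p} {n} S = go (allFin p)
  where
  go : ∀ is → length (filterᵇ S (concatMap (λ i → map (i ∷_) (allPts p n)) is))
            ≡ sum (map (λ i → card p n (S ∘ (i ∷_))) is)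
  go []       = refl
  go (i ∷ is) = trans (length-filterᵇ-++ S (map (i ∷_) (allPts p n)) _)
    (cong₂ ℕ._+_ (length-filterᵇ-map S (i ∷_) (allPts p n)) (go is))

∈⇒≤sum : ∀ {A : Set} (c : A → ℕ) {x xs} → x ∈ xs → c x ℕ.≤ sum (map c xs)
∈⇒≤sum c {xs = x ∷ xs} (here refl) = ℕ.m≤m+n (c x) _
∈⇒≤sum c {xs = x ∷ xs} (there x∈xs) = ℕ.≤-trans (∈⇒≤sum c x∈xs) (ℕ.m≤n+m _ (c x))

card-pos : ∀ {p n} (S : Subset p n) x → S x ≡ true → 0 ℕ.< card p n S
card-pos S [] Sx with S [] | Sx
... | true | refl = s≤s z≤n
card-pos {p} {suc n} S (i ∷ x) Sx = ℕ.<-≤-trans (card-pos (S ∘ (i ∷_)) x Sx)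
  (ℕ.≤-trans (∈⇒≤sum (λ j → card p n (S ∘ (j ∷_))) (∈-allFin i)) (ℕ.≤-reflexive (sym (card-suc S))))

card-empty : ∀ {p n} (S : Subset p n) → (∀ x → S x ≡ false) → card p n S ≡ 0
card-empty {p} {n} S S∅ = go (allPts p n)
  where
  go : ∀ xs → length (filterᵇ S xs) ≡ 0
  go [] = refl
  go (x ∷ xs) rewrite S∅ x = go xs

-- The witness minimises `c` on its support: at each step the smaller of the old witness and the new
-- element is kept. The alternative of sum 0 accounts for an empty support. This selects the slice
-- in `dominantSlice`.
length*min≤sum : ∀ {A : Set} (c : A → ℕ) xs → let supp = filter (λ x → 0 ℕ.<? c x) xs in
  (sum (map c xs) ≡ 0) ⊎ ∃ λ x → x ∈ supp × length supp ℕ.* c x ℕ.≤ sum (map c xs)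
length*min≤sum c [] = inj₁ refl
length*min≤sum c (y ∷ ys) with c y in cy
length*min≤sum c (y ∷ ys) | zero = length*min≤sum c ys
length*min≤sum c (y ∷ ys) | suc k with length*min≤sum c ys
... | inj₁ ∑≡0 = inj₂ (y , here refl , (begin
    suc l ℕ.* c y       ≡⟨ cong₂ ℕ._*_ (cong suc (ℕ.n≤0⇒n≡0 (l≤0))) cy ⟩
    1 ℕ.* suc k         ≡⟨ ℕ.*-identityˡ (suc k) ⟩
    suc k               ≤⟨ ℕ.m≤m+n (suc k) _ ⟩
    suc k ℕ.+ sum (map c ys) ∎))
  where
  open ℕ.≤-Reasoning
  l = length (filter (λ x → 0 ℕ.<? c x) ys)
  length≤sum : ∀ xs → length (filter (λ x → 0 ℕ.<? c x) xs) ℕ.≤ sum (map c xs)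
  length≤sum [] = z≤n
  length≤sum (x ∷ xs) with c x
  ... | zero = length≤sum xs
  ... | suc n = s≤s (ℕ.≤-trans (length≤sum xs) (ℕ.m≤n+m _ n))
  l≤0 : l ℕ.≤ 0
  l≤0 = ℕ.≤-trans (length≤sum ys) (ℕ.≤-reflexive ∑≡0)
... | inj₂ (x , x∈ , h) with ℕ.≤-total (c x) (suc k)
...   | inj₁ cx≤cy = inj₂ (x , there x∈ , ℕ.+-mono-≤ cx≤cy h)
...   | inj₂ cy≤cx = inj₂ (y , here refl , subst (λ z → suc l ℕ.* z ℕ.≤ suc k ℕ.+ sum (map c ys)) (sym cy)
        (ℕ.+-monoʳ-≤ (suc k) (ℕ.≤-trans (ℕ.*-monoʳ-≤ l cy≤cx) h)))
  where l = length (filter (λ x → 0 ℕ.<? c x) ys)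

-- For k > 0 this is the monotonicity of (1 + x)^(1/x). Induction on q starts from equality at q =
-- k; raising q by one multiplies the left side by at most k + 1, by `step`, and the right side by
-- exactly k + 1.
[1+q]^k≤[1+k]^q : ∀ {k q} → k ℕ.≤ q → suc q ℕ.^ k ℕ.≤ suc k ℕ.^ q
[1+q]^k≤[1+k]^q k≤q = go (ℕ.≤⇒≤′ k≤q)
  where
  open ℕ.≤-Reasoning
  step : ∀ {q} k → k ℕ.≤ q → suc (suc q) ℕ.^ k ℕ.≤ suc k ℕ.* suc q ℕ.^ k
  step zero _ = ℕ.≤-refl
  step {q} (suc k) k<q = begin
    (2 ℕ.+ q) ℕ.* suc (suc q) ℕ.^ k           ≤⟨ ℕ.*-monoʳ-≤ (2 ℕ.+ q) (step k (ℕ.<⇒≤ k<q)) ⟩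
    (2 ℕ.+ q) ℕ.* (suc k ℕ.* E)               ≡⟨ lem₁ q k E ⟩
    (2 ℕ.+ q ℕ.+ k ℕ.* q ℕ.+ k ℕ.+ k) ℕ.* E   ≤⟨ ℕ.*-monoˡ-≤ E (ℕ.+-monoʳ-≤ (2 ℕ.+ q ℕ.+ k ℕ.* q ℕ.+ k) (ℕ.<⇒≤ k<q)) ⟩
    (2 ℕ.+ q ℕ.+ k ℕ.* q ℕ.+ k ℕ.+ q) ℕ.* E   ≡⟨ lem₂ q k E ⟩
    (2 ℕ.+ k) ℕ.* (suc q ℕ.* E)               ∎
    where
    E = suc q ℕ.^ k
    lem₁ : ∀ q k E → (2 ℕ.+ q) ℕ.* ((1 ℕ.+ k) ℕ.* E) ≡ (2 ℕ.+ q ℕ.+ k ℕ.* q ℕ.+ k ℕ.+ k) ℕ.* E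
    lem₁ = solveℕ-∀
    lem₂ : ∀ q k E → (2 ℕ.+ q ℕ.+ k ℕ.* q ℕ.+ k ℕ.+ q) ℕ.* E ≡ (2 ℕ.+ k) ℕ.* ((1 ℕ.+ q) ℕ.* E)
    lem₂ = solveℕ-∀
  go : ∀ {k q} → k ℕ.≤′ q → suc q ℕ.^ k ℕ.≤ suc k ℕ.^ q
  go ℕ.≤′-refl = ℕ.≤-refl
  go {k} {suc q} (ℕ.≤′-step k≤q) =
    ℕ.≤-trans (step k (ℕ.≤′⇒≤ k≤q)) (ℕ.*-monoʳ-≤ (suc k) (go k≤q))

allᵇ-elim : ∀ {A : Set} {f : A → Bool} {xs} → allᵇ f xs ≡ true → ∀ {x} → x ∈ xs → f x ≡ true
allᵇ-elim {f = f} {y ∷ ys} all (here refl) with f y | all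
... | true | _ = refl
allᵇ-elim {f = f} {y ∷ ys} all (there x∈) with f y | all
... | true | all′ = allᵇ-elim all′ x∈

allᵇ-intro : ∀ {A : Set} {f : A → Bool} xs → (∀ x → f x ≡ true) → allᵇ f xs ≡ true
allᵇ-intro []       h = refl
allᵇ-intro (x ∷ xs) h rewrite h x = allᵇ-intro xs h

length-filterᵇ-cartesianProduct : ∀ {A B : Set} (S : A × B → Bool) xs ys →
  length (filterᵇ S (cartesianProduct xs ys)) ≡ sum (map (λ x → length (filterᵇ (λ y → S (x , y)) ys)) xs)
length-filterᵇ-cartesianProduct S []       ys = refl
length-filterᵇ-cartesianProduct S (x ∷ xs) ys = trans (length-filterᵇ-++ S (map (x ,_) ys) _)
  (cong₂ ℕ._+_ (length-filterᵇ-map S (x ,_) ys) (length-filterᵇ-cartesianProduct S xs ys))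

sum-map-concatMap : ∀ {A B : Set} (f : B → ℕ) (g : A → List B) xs →
  sum (map f (concatMap g xs)) ≡ sum (map (λ x → sum (map f (g x))) xs)
sum-map-concatMap f g []       = refl
sum-map-concatMap f g (x ∷ xs) = trans (cong sum (L.map-++ f (g x) (concatMap g xs)))
  (trans (sum-++ (map f (g x)) _) (cong (sum (map f (g x)) ℕ.+_) (sum-map-concatMap f g xs)))

card-++ : ∀ {p} n {m} (S : Subset p (n ℕ.+ m)) →
  card p (n ℕ.+ m) S ≡ sum (map (λ x → card p m (λ y → S (x V.++ y))) (allPts p n))
card-++ zero S = sym (ℕ.+-identityʳ _)
card-++ {p} (suc n) {m} S = begin
  card p (suc n ℕ.+ m) S
    ≡⟨ card-suc S ⟩
  sum (map (λ i → card p (n ℕ.+ m) (S ∘ (i ∷_))) (allFin p))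
    ≡⟨ cong sum (L.map-cong (λ i → trans (card-++ n (S ∘ (i ∷_))) (cong sum (L.map-∘ (allPts p n)))) (allFin p)) ⟩
  sum (map (λ i → sum (map φ (map (i ∷_) (allPts p n)))) (allFin p))
    ≡⟨ sum-map-concatMap φ (λ i → map (i ∷_) (allPts p n)) (allFin p) ⟨
  sum (map φ (allPts p (suc n))) ∎
  where
  open ≡-Reasoning
  φ : Pt p (suc n) → ℕ
  φ x = card p m (λ y → S (x V.++ y))

-- Turns the count of lines (x , d) into the count of points of a subset of F_p^(2n), to which a
-- bound on supports applies.
card-pairs : ∀ {p} n {m} (S : Subset p (n ℕ.+ m)) →
  card p (n ℕ.+ m) S
    ≡ length (filterᵇ (uncurry λ x y → S (x V.++ y)) (cartesianProduct (allPts p n) (allPts p m)))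
card-pairs {p} n {m} S =
  trans (card-++ n S) (sym (length-filterᵇ-cartesianProduct (uncurry λ x y → S (x V.++ y)) (allPts p n) (allPts p m)))

funToFin-cong : ∀ {m n} {f g : Fin m → Fin n} → (∀ i → f i ≡ g i) → funToFin f ≡ funToFin g
funToFin-cong {zero}  f≗g = refl
funToFin-cong {suc m} f≗g = cong₂ Fin.combine (f≗g Fin.zero) (funToFin-cong (f≗g ∘ Fin.suc))

finToFun-injective : ∀ {m n} {a b : Fin (n ℕ.^ m)} →
  (∀ i → finToFun {n} {m} a i ≡ finToFun b i) → a ≡ b
finToFun-injective {m} {n} {a} {b} eq =
  trans (sym (Fin.funToFin-finToFin {m} {n} a)) (trans (funToFin-cong eq) (Fin.funToFin-finToFin {m} {n} b))

∈-allPts : ∀ {p n} (x : Pt p n) → x ∈ allPts p n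
∈-allPts []      = here refl
∈-allPts (i ∷ x) = ∈-concatMap⁺ _ (Any.map (λ { refl → ∈-map⁺ (i ∷_) (∈-allPts x) }) (∈-allFin i))

inhabited? : ∀ {p} n (S : Subset p n) → Dec (∃ λ x → S x ≡ true)
inhabited? zero    S = map′ (λ S[] → [] , S[]) (λ { ([] , S[]) → S[] }) (S [] Bool.≟ true)
inhabited? (suc n) S = map′ (λ { (i , x , Sx) → i ∷ x , Sx }) (λ { (i ∷ x , Sx) → i , x , Sx })
  (Fin.any? λ i → inhabited? n (S ∘ (i ∷_)))

^-distribʳ-* : ∀ k a b → (a ℕ.* b) ℕ.^ k ≡ a ℕ.^ k ℕ.* b ℕ.^ k
^-distribʳ-* zero    a b = refl
^-distribʳ-* (suc k) a b = trans (cong (a ℕ.* b ℕ.*_) (^-distribʳ-* k a b)) (interchange a b (a ℕ.^ k) (b ℕ.^ k))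
  where open import Algebra.Properties.CommutativeSemigroup ℕ.*-commutativeSemigroup

-- The number of monomials of degree k in m + 1 variables. The recursion is that of `form`, so that
-- an index of a coefficient splits into one for each summand.
dim : ℕ → ℕ → ℕ
dim zero    k       = 1
dim (suc m) zero    = 1
dim (suc m) (suc k) = dim m (suc k) ℕ.+ dim (suc m) k

dim≡C : ∀ m k → dim m k ≡ (m ℕ.+ k) C k
dim≡C zero    k       = sym (nCn≡1 k)
dim≡C (suc m) zero    = refl
dim≡C (suc m) (suc k) = begin
  dim m (suc k) ℕ.+ dim (suc m) k                   ≡⟨ cong₂ ℕ._+_ (dim≡C m (suc k)) (dim≡C (suc m) k) ⟩
  (m ℕ.+ suc k) C suc k ℕ.+ suc (m ℕ.+ k) C k       ≡⟨ ℕ.+-comm ((m ℕ.+ suc k) C suc k) _ ⟩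
  suc (m ℕ.+ k) C k ℕ.+ (m ℕ.+ suc k) C suc k       ≡⟨ cong (λ n → n C k ℕ.+ (m ℕ.+ suc k) C suc k) (ℕ.+-suc m k) ⟨
  (m ℕ.+ suc k) C k ℕ.+ (m ℕ.+ suc k) C suc k       ≡⟨ nCk+nC[k+1]≡[n+1]C[k+1] (m ℕ.+ suc k) k ⟩
  suc (m ℕ.+ suc k) C suc k                         ∎
  where open ≡-Reasoning

-- Vectors of natural numbers and lines

infixl 6 _⊕_

_⊕_ : ∀ {n} → Vec ℕ n → Vec ℕ n → Vec ℕ n
_⊕_ = zipWith ℕ._+_

⊕-interchange : ∀ {n} (a b c d : Vec ℕ n) → (a ⊕ b) ⊕ (c ⊕ d) ≡ (a ⊕ c) ⊕ (b ⊕ d)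
⊕-interchange [] [] [] [] = refl
⊕-interchange (a ∷ as) (b ∷ bs) (c ∷ cs) (d ∷ ds) =
  cong₂ _∷_ (interchange a b c d) (⊕-interchange as bs cs ds)
  where open import Algebra.Properties.CommutativeSemigroup ℕ.+-commutativeSemigroup

⊕-swapʳ : ∀ {n} (a b c : Vec ℕ n) → (a ⊕ b) ⊕ c ≡ (a ⊕ c) ⊕ b
⊕-swapʳ a b c = trans (V.zipWith-assoc ℕ.+-assoc a b c)
  (trans (cong (a ⊕_) (V.zipWith-comm ℕ.+-comm b c)) (sym (V.zipWith-assoc ℕ.+-assoc a c b)))

0⃗ : ∀ {n} → Vec ℕ n
0⃗ = replicate _ 0

⊕-identityʳ : ∀ {n} (a : Vec ℕ n) → a ⊕ 0⃗ ≡ a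
⊕-identityʳ = V.zipWith-identityʳ ℕ.+-identityʳ

⊕-identityˡ : ∀ {n} (a : Vec ℕ n) → 0⃗ ⊕ a ≡ a
⊕-identityˡ = V.zipWith-identityˡ ℕ.+-identityˡ

infixr 7 _⊙_

_⊙_ : ∀ {n} → ℕ → Vec ℕ n → Vec ℕ n
l ⊙ x = V.map (l ℕ.*_) x

line : ∀ {n} → ℕ → Vec ℕ n → Vec ℕ n → Vec ℕ n
line l x d = x ⊕ l ⊙ d

⊙-distribˡ-⊕ : ∀ {n} l (x y : Vec ℕ n) → l ⊙ (x ⊕ y) ≡ l ⊙ x ⊕ l ⊙ y
⊙-distribˡ-⊕ l []       []       = refl
⊙-distribˡ-⊕ l (x ∷ xs) (y ∷ ys) = cong₂ _∷_ (ℕ.*-distribˡ-+ l x y) (⊙-distribˡ-⊕ l xs ys)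

⊙-distribʳ-+ : ∀ {n} l l′ (x : Vec ℕ n) → (l ℕ.+ l′) ⊙ x ≡ l ⊙ x ⊕ l′ ⊙ x
⊙-distribʳ-+ l l′ []       = refl
⊙-distribʳ-+ l l′ (x ∷ xs) = cong₂ _∷_ (ℕ.*-distribʳ-+ x l l′) (⊙-distribʳ-+ l l′ xs)

line-⊕ : ∀ {n} l (x h d k : Vec ℕ n) → line l (x ⊕ h) (d ⊕ k) ≡ line l x d ⊕ line l h k
line-⊕ l x h d k = trans (cong ((x ⊕ h) ⊕_) (⊙-distribˡ-⊕ l d k)) (⊕-interchange x h (l ⊙ d) (l ⊙ k))

-- Linearity in (l , x) for fixed d: it lets l serve as the first coordinate of a function on
-- ℕ^(n+1), over which `deg-∑` can sum.
line-⊕-+ : ∀ {n} l l′ (x h d : Vec ℕ n) → line (l ℕ.+ l′) (x ⊕ h) d ≡ line l x d ⊕ line l′ h d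
line-⊕-+ l l′ x h d = trans (cong ((x ⊕ h) ⊕_) (⊙-distribʳ-+ l l′ d)) (⊕-interchange x h (l ⊙ d) (l′ ⊙ d))

take-coords : ∀ {p n m} (x : Pt p n) (y : Pt p m) → V.take n (V.map toℕ (x V.++ y)) ≡ V.map toℕ x
take-coords []      y = refl
take-coords (i ∷ x) y = cong (toℕ i ∷_) (take-coords x y)

drop-coords : ∀ {p n m} (x : Pt p n) (y : Pt p m) → V.drop n (V.map toℕ (x V.++ y)) ≡ V.map toℕ y
drop-coords []      y = refl
drop-coords (i ∷ x) y = drop-coords x y

map-toℕ-zeros : ∀ {p} n → V.map toℕ (replicate n (Fin.zero {p})) ≡ 0⃗
map-toℕ-zeros n = V.map-replicate toℕ Fin.zero n

-- Integer-valued functions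

module IntegerFunctions where
  open import Data.Integer using (ℤ; +_; 0ℤ; 1ℤ; _+_; _*_; _-_; -_; _^_)

  Δ : ∀ {n} → Vec ℕ n → (Vec ℕ n → ℤ) → Vec ℕ n → ℤ
  Δ h f x = f (x ⊕ h) - f x

  ∑< : ℕ → (ℕ → ℤ) → ℤ
  ∑< zero    f = 0ℤ
  ∑< (suc n) f = ∑< n f + f n

  ∏< : ℕ → (ℕ → ℤ) → ℤ
  ∏< zero    f = 1ℤ
  ∏< (suc n) f = ∏< n f * f n

  ∑<-distribˡ : ∀ n a f → ∑< n (λ t → a * f t) ≡ a * ∑< n f
  ∑<-distribˡ zero    a f = sym (ℤ.*-zeroʳ a)
  ∑<-distribˡ (suc n) a f = trans (cong (_+ a * f n) (∑<-distribˡ n a f)) (sym (ℤ.*-distribˡ-+ a _ _))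

  ∑<-distrib-minus : ∀ n f g → ∑< n (λ t → f t - g t) ≡ ∑< n f - ∑< n g
  ∑<-distrib-minus zero    f g = refl
  ∑<-distrib-minus (suc n) f g = trans (cong (_+ (f n - g n)) (∑<-distrib-minus n f g))
    (lem (∑< n f) (∑< n g) (f n) (g n))
    where
    lem : ∀ a b c d → (a - b) + (c - d) ≡ (a + c) - (b + d)
    lem = solve-∀

  -- The rising factorial n (n + 1) ⋯ (n + k - 1), the weight that arises when summation by parts is
  -- repeated.
  rising : ℕ → ℕ → ℤ
  rising zero    n = 1ℤ
  rising (suc k) n = + n * rising k (suc n)

  rising-last : ∀ k n → rising (suc k) n ≡ rising k n * (+ n + + k)
  rising-last zero    n = lem (+ n)
    where
    lem : ∀ a → a * 1ℤ ≡ 1ℤ * (a + 0ℤ)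
    lem = solve-∀
  rising-last (suc k) n = trans (cong (+ n *_) (rising-last k (suc n))) (lem (+ n) (+ k) _)
    where
    lem : ∀ a b w → a * (w * ((1ℤ + a) + b)) ≡ a * w * (a + (1ℤ + b))
    lem = solve-∀

  -- The product `rising (suc k) t * u t` telescopes from the value 0 at t = 0. Its increment splits
  -- by the product rule, since `rising (suc k)` grows by (k + 1) `rising k (suc t)` from t to t +
  -- 1.
  summation-by-parts : ∀ k (u : ℕ → ℤ) n →
    + suc k * ∑< n (λ t → rising k (suc t) * u t)
      + ∑< n (λ t → rising (suc k) (suc t) * (u (suc t) - u t))
    ≡ rising (suc k) n * u n
  summation-by-parts k u zero    = trans (cong (_+ 0ℤ) (ℤ.*-zeroʳ (+ suc k))) refl
  summation-by-parts k u (suc n) = begin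
    + suc k * (S + w * u n) + (T + rising (suc k) (suc n) * (u (suc n) - u n))
      ≡⟨ lem₁ (+ suc k) S w (u n) T _ ⟩
    (+ suc k * S + T) + (+ suc k * w * u n + rising (suc k) (suc n) * (u (suc n) - u n))
      ≡⟨ cong₂ (λ a b → a + (+ suc k * w * u n + b * (u (suc n) - u n)))
           (summation-by-parts k u n) (rising-last k (suc n)) ⟩
    + n * w * u n + (+ suc k * w * u n + w * (+ suc n + + k) * (u (suc n) - u n))
      ≡⟨ lem₂ (+ n) (+ k) w (u n) (u (suc n)) ⟩
    w * (+ suc n + + k) * u (suc n)
      ≡⟨ cong (_* u (suc n)) (sym (rising-last k (suc n))) ⟩
    rising (suc k) (suc n) * u (suc n) ∎
    where
    open ≡-Reasoning
    w = rising k (suc n)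
    S = ∑< n (λ t → rising k (suc t) * u t)
    T = ∑< n (λ t → rising (suc k) (suc t) * (u (suc t) - u t))
    lem₁ : ∀ c S w u T x → c * (S + w * u) + (T + x) ≡ (c * S + T) + (c * w * u + x)
    lem₁ = solve-∀
    lem₂ : ∀ n k w u v → n * w * u + ((1ℤ + k) * w * u + w * ((1ℤ + n) + k) * (v - u))
                       ≡ w * ((1ℤ + n) + k) * v
    lem₂ = solve-∀

  ^-distribʳ-*ℤ : ∀ k a b → (a * b) ^ k ≡ a ^ k * b ^ k
  ^-distribʳ-*ℤ zero    a b = refl
  ^-distribʳ-*ℤ (suc k) a b = trans (cong (a * b *_) (^-distribʳ-*ℤ k a b)) (lem a b (a ^ k) (b ^ k))
    where
    lem : ∀ a b c d → a * b * (c * d) ≡ (a * c) * (b * d)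
    lem = solve-∀

  -- The homogeneous form of degree k in m + 1 variables with coefficients c: a form of positive
  -- degree splits as f₀(x₂, …) + x₁ f₁(x₁, …), which is Pascal's rule for the number of monomials.
  form : ∀ m k → (Fin (dim m k) → ℤ) → Vec ℕ (suc m) → ℤ
  form zero    k       c x = c Fin.zero * (+ V.head x) ^ k
  form (suc m) zero    c x = c Fin.zero
  form (suc m) (suc k) c x =
    form m (suc k) (λ i → c (i ↑ˡ dim (suc m) k)) (V.tail x)
      + + V.head x * form (suc m) k (λ i → c (dim m (suc k) ↑ʳ i)) x

  form-minus : ∀ m k c c′ x → form m k (λ i → c i - c′ i) x ≡ form m k c x - form m k c′ x
  form-minus zero    k       c c′ x = lem (c Fin.zero) (c′ Fin.zero) ((+ V.head x) ^ k)
    where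
    lem : ∀ a b y → (a - b) * y ≡ a * y - b * y
    lem = solve-∀
  form-minus (suc m) zero    c c′ x = refl
  form-minus (suc m) (suc k) c c′ x =
    trans (cong₂ (λ a b → a + + V.head x * b) (form-minus m (suc k) _ _ (V.tail x)) (form-minus (suc m) k _ _ x))
      (lem (F c) (F c′) (+ V.head x) (G c) (G c′))
    where
    F G : (Fin (dim (suc m) (suc k)) → ℤ) → ℤ
    F c = form m (suc k) (λ i → c (i ↑ˡ dim (suc m) k)) (V.tail x)
    G c = form (suc m) k (λ i → c (dim m (suc k) ↑ʳ i)) x
    lem : ∀ a b y e f → (a - b) + y * (e - f) ≡ (a + y * e) - (b + y * f)
    lem = solve-∀

  form-homogeneous : ∀ m k c l x → form m k c (l ⊙ x) ≡ (+ l) ^ k * form m k c x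
  form-homogeneous zero    k       c l (x ∷ []) =
    trans (cong (c Fin.zero *_) (trans (cong (_^ k) (ℤ.pos-* l x)) (^-distribʳ-*ℤ k (+ l) (+ x))))
      (lem (c Fin.zero) ((+ l) ^ k) ((+ x) ^ k))
    where
    lem : ∀ a b y → a * (b * y) ≡ b * (a * y)
    lem = solve-∀
  form-homogeneous (suc m) zero    c l x = sym (ℤ.*-identityˡ (c Fin.zero))
  form-homogeneous (suc m) (suc k) c l (x ∷ xs) =
    trans (cong₂ _+_ (form-homogeneous m (suc k) _ l xs)
            (cong₂ _*_ (ℤ.pos-* l x) (form-homogeneous (suc m) k _ l (x ∷ xs))))
      (lem (+ l) ((+ l) ^ k) (form m (suc k) _ xs) (+ x) (form (suc m) k _ (x ∷ xs)))
    where
    lem : ∀ l L f x g → l * L * f + (l * x) * (L * g) ≡ l * L * (f + x * g)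
    lem = solve-∀

-- Polynomial functions modulo p

module Modulo (q : ℕ) (p-prime : Prime (suc q)) where
  open import Data.Integer using (ℤ; +_; 0ℤ; 1ℤ; _+_; _*_; _-_; -_; _^_; ∣_∣)
  open IntegerFunctions

  p : ℕ
  p = suc q

  -- Congruence modulo p

  infix 4 _≋_

  -- A record rather than a plain divisibility, so that both sides can be inferred from the type.
  record _≋_ (a b : ℤ) : Set where
    constructor congruent
    field ∣-diff : + p ∣ a - b

  ≋-reflexive : ∀ {a b} → a ≡ b → a ≋ b
  ≋-reflexive {a} refl = congruent (subst (+ p ∣_) (sym (ℤ.+-inverseʳ a)) (divides 0ℤ refl))

  ≋-refl : ∀ {a} → a ≋ a
  ≋-refl = ≋-reflexive refl

  ≋-sym : ∀ {a b} → a ≋ b → b ≋ a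
  ≋-sym {a} {b} (congruent h) = congruent (subst (+ p ∣_) (lem a b) (∣m⇒∣-m h))
    where
    lem : ∀ a b → - (a - b) ≡ b - a
    lem = solve-∀

  ≋-trans : ∀ {a b c} → a ≋ b → b ≋ c → a ≋ c
  ≋-trans {a} {b} {c} (congruent h) (congruent k) =
    congruent (subst (+ p ∣_) (lem a b c) (∣m∣n⇒∣m+n h k))
    where
    lem : ∀ a b c → (a - b) + (b - c) ≡ a - c
    lem = solve-∀

  ≋-setoid : Setoid _ _
  ≋-setoid = record
    { _≈_ = _≋_
    ; isEquivalence = record { refl = ≋-refl ; sym = ≋-sym ; trans = ≋-trans } }

  module ≋-Reasoning = SetoidReasoning ≋-setoid

  +-cong : ∀ {a b c d} → a ≋ b → c ≋ d → a + c ≋ b + d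
  +-cong {a} {b} {c} {d} (congruent h) (congruent k) =
    congruent (subst (+ p ∣_) (lem a b c d) (∣m∣n⇒∣m+n h k))
    where
    lem : ∀ a b c d → (a - b) + (c - d) ≡ (a + c) - (b + d)
    lem = solve-∀

  *-cong : ∀ {a b c d} → a ≋ b → c ≋ d → a * c ≋ b * d
  *-cong {a} {b} {c} {d} (congruent h) (congruent k) =
    congruent (subst (+ p ∣_) (lem a b c d) (∣m∣n⇒∣m+n (∣m⇒∣m*n c h) (∣n⇒∣m*n b k)))
    where
    lem : ∀ a b c d → (a - b) * c + b * (c - d) ≡ a * c - b * d
    lem = solve-∀

  -‿cong : ∀ {a b} → a ≋ b → - a ≋ - b
  -‿cong {a} {b} (congruent h) = congruent (subst (+ p ∣_) (lem a b) (∣m⇒∣-m h))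
    where
    lem : ∀ a b → - (a - b) ≡ - a - - b
    lem = solve-∀

  minus-cong : ∀ {a b c d} → a ≋ b → c ≋ d → a - c ≋ b - d
  minus-cong h k = +-cong h (-‿cong k)

  ^-cong : ∀ {a b} k → a ≋ b → a ^ k ≋ b ^ k
  ^-cong zero    h = ≋-refl
  ^-cong (suc k) h = *-cong h (^-cong k h)

  ∣⇒≋0 : ∀ {a} → + p ∣ a → a ≋ 0ℤ
  ∣⇒≋0 {a} h = congruent (subst (+ p ∣_) (sym (ℤ.+-identityʳ a)) h)

  ≋0⇒∣ : ∀ {a} → a ≋ 0ℤ → + p ∣ a
  ≋0⇒∣ {a} (congruent h) = subst (+ p ∣_) (ℤ.+-identityʳ a) h

  ≋⇒-≋0 : ∀ {a b} → a ≋ b → a - b ≋ 0ℤ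
  ≋⇒-≋0 (congruent h) = ∣⇒≋0 h

  -≋0⇒≋ : ∀ {a b} → a - b ≋ 0ℤ → a ≋ b
  -≋0⇒≋ h = congruent (≋0⇒∣ h)

  *-zeroˡ-≋ : ∀ {a} b → a ≋ 0ℤ → a * b ≋ 0ℤ
  *-zeroˡ-≋ b h = ≋-trans (*-cong h ≋-refl) (≋-reflexive (ℤ.*-zeroˡ b))

  *-zeroʳ-≋ : ∀ a {b} → b ≋ 0ℤ → a * b ≋ 0ℤ
  *-zeroʳ-≋ a h = ≋-trans (*-cong (≋-refl {a}) h) (≋-reflexive (ℤ.*-zeroʳ a))

  *-cancel-≋0 : ∀ {a b} → ¬ a ≋ 0ℤ → a * b ≋ 0ℤ → b ≋ 0ℤ
  *-cancel-≋0 {a} {b} a≉0 ab≋0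
    with euclidsLemma ∣ a ∣ ∣ b ∣ p-prime (subst (p ℕ.∣_) (ℤ.abs-* a b) (∣⇒∣ᵤ (≋0⇒∣ ab≋0)))
  ... | inj₁ p∣a = contradiction (∣⇒≋0 (∣ᵤ⇒∣ p∣a)) a≉0
  ... | inj₂ p∣b = ∣⇒≋0 (∣ᵤ⇒∣ p∣b)

  p≋0 : + p ≋ 0ℤ
  p≋0 = ∣⇒≋0 ∣-refl

  small≉0 : ∀ {k} → 0 ℕ.< k → k ℕ.< p → ¬ + k ≋ 0ℤ
  small≉0 {suc k} _ k<p h = ℕ.>⇒∤ k<p (∣⇒∣ᵤ (≋0⇒∣ h))

  1<p : 1 ℕ.< p
  1<p = ℕ.nonTrivial⇒n>1 p {{prime⇒nonTrivial p-prime}}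

  1≉0 : ¬ 1ℤ ≋ 0ℤ
  1≉0 = small≉0 (s≤s z≤n) 1<p

  -- Degree by iterated differences

  -- The directions h are arbitrary, so this bounds the total degree. The strict bound makes
  -- vanishing the case m = 0, without a degree of minus infinity. On ℕ^n, unlike F_p^n, affine
  -- substitutions need no reduction modulo p.
  data Deg< {n : ℕ} : ℕ → (Vec ℕ n → ℤ) → Set where
    zero : ∀ {f} → (∀ x → f x ≋ 0ℤ) → Deg< 0 f
    suc  : ∀ {m f} → (∀ h → Deg< m (Δ h f)) → Deg< (suc m) f

  deg<0 : ∀ {n} {f : Vec ℕ n → ℤ} → Deg< 0 f → ∀ x → f x ≋ 0ℤ
  deg<0 (zero f≋0) = f≋0

  deg-cong : ∀ {n m} {f g : Vec ℕ n → ℤ} → (∀ x → f x ≋ g x) → Deg< m f → Deg< m g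
  deg-cong f≋g (zero f≋0) = zero λ x → ≋-trans (≋-sym (f≋g x)) (f≋0 x)
  deg-cong f≋g (suc df)   = suc λ h → deg-cong (λ x → minus-cong (f≋g (x ⊕ h)) (f≋g x)) (df h)

  deg-zero : ∀ {n} m {f : Vec ℕ n → ℤ} → (∀ x → f x ≋ 0ℤ) → Deg< m f
  deg-zero zero    f≋0 = zero f≋0
  deg-zero (suc m) f≋0 = suc λ h → deg-zero m λ x → minus-cong (f≋0 (x ⊕ h)) (f≋0 x)

  deg-mono : ∀ {n m m′} {f : Vec ℕ n → ℤ} → m ℕ.≤ m′ → Deg< m f → Deg< m′ f
  deg-mono _          (zero f≋0) = deg-zero _ f≋0
  deg-mono (s≤s m≤m′) (suc df)   = suc λ h → deg-mono m≤m′ (df h)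

  deg-≡ : ∀ {n m m′} {f : Vec ℕ n → ℤ} → m ≡ m′ → Deg< m f → Deg< m′ f
  deg-≡ refl df = df

  deg-+ : ∀ {n m} {f g : Vec ℕ n → ℤ} → Deg< m f → Deg< m g → Deg< m (λ x → f x + g x)
  deg-+ (zero f≋0) (zero g≋0) = zero λ x → +-cong (f≋0 x) (g≋0 x)
  deg-+ {f = f} {g} (suc df) (suc dg) = suc λ h →
    deg-cong (λ x → ≋-reflexive (lem (f (x ⊕ h)) (f x) (g (x ⊕ h)) (g x))) (deg-+ (df h) (dg h))
    where
    lem : ∀ a b c d → (a - b) + (c - d) ≡ (a + c) - (b + d)
    lem = solve-∀

  deg-scale : ∀ {n m} {f : Vec ℕ n → ℤ} a → Deg< m f → Deg< m (λ x → a * f x)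
  deg-scale a (zero f≋0) = zero λ x → *-zeroʳ-≋ a (f≋0 x)
  deg-scale {f = f} a (suc df) = suc λ h →
    deg-cong (λ x → ≋-reflexive (lem a (f (x ⊕ h)) (f x))) (deg-scale a (df h))
    where
    lem : ∀ a b c → a * (b - c) ≡ a * b - a * c
    lem = solve-∀

  deg-unscale : ∀ {n m} {f : Vec ℕ n → ℤ} {a} → ¬ a ≋ 0ℤ → Deg< m (λ x → a * f x) → Deg< m f
  deg-unscale a≉0 (zero af≋0) = zero λ x → *-cancel-≋0 a≉0 (af≋0 x)
  deg-unscale {f = f} {a} a≉0 (suc daf) = suc λ h →
    deg-unscale a≉0 (deg-cong (λ x → ≋-reflexive (lem a (f (x ⊕ h)) (f x))) (daf h))
    where
    lem : ∀ a b c → a * b - a * c ≡ a * (b - c)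
    lem = solve-∀

  deg-minus : ∀ {n m} {f g : Vec ℕ n → ℤ} → Deg< m f → Deg< m g → Deg< m (λ x → f x - g x)
  deg-minus {f = f} {g} df dg =
    deg-cong (λ x → ≋-reflexive (lem (f x) (g x))) (deg-+ df (deg-scale (- 1ℤ) dg))
    where
    lem : ∀ a b → a + - 1ℤ * b ≡ a - b
    lem = solve-∀

  deg-const : ∀ {n} c → Deg< {n} 1 (λ _ → c)
  deg-const c = suc λ h → zero λ x → ≋⇒-≋0 (≋-refl {c})

  -- `L` is the linear part of the affine map `A`: the difference of f ∘ A in direction h is the
  -- difference of f in direction L h, composed with A.
  deg-∘ : ∀ {n n′ m} {f : Vec ℕ n → ℤ} (A L : Vec ℕ n′ → Vec ℕ n) →
    (∀ x h → A (x ⊕ h) ≡ A x ⊕ L h) → Deg< m f → Deg< m (f ∘ A)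
  deg-∘ A L A-affine (zero f≋0) = zero λ x → f≋0 (A x)
  deg-∘ {f = f} A L A-affine (suc df) = suc λ h →
    deg-cong (λ x → ≋-reflexive (cong (λ y → f y - f (A x)) (sym (A-affine x h))))
      (deg-∘ A L A-affine (df (L h)))

  deg-shift : ∀ {n m} {f : Vec ℕ n → ℤ} h → Deg< m f → Deg< m (λ x → f (x ⊕ h))
  deg-shift h = deg-∘ (_⊕ h) (λ x → x) λ x k → ⊕-swapʳ x k h

  -- Degrees at most a - 1 and b - 1 add up to at most a + b - 2, whence the predecessor. The
  -- induction uses the Leibniz rule Δ(f g) = Δf · g(x + h) + f · Δg.
  deg-* : ∀ {n a b} {f g : Vec ℕ n → ℤ} →
    Deg< a f → Deg< b g → Deg< (ℕ.pred (a ℕ.+ b)) (λ x → f x * g x)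
  deg-* {g = g} (zero f≋0) _ = deg-zero _ λ x → *-zeroˡ-≋ (g x) (f≋0 x)
  deg-* {f = f} (suc _) (zero g≋0) = deg-zero _ λ x → *-zeroʳ-≋ (f x) (g≋0 x)
  deg-* {a = suc a} {suc b} {f} {g} (suc df) (suc dg) =
    deg-≡ (sym (ℕ.+-suc a b)) (suc λ h →
      deg-cong (λ x → ≋-reflexive (lem (f (x ⊕ h)) (f x) (g (x ⊕ h)) (g x)))
        (deg-+
          (deg-≡ (cong ℕ.pred (ℕ.+-suc a b))
            (deg-* (df h) (deg-shift {f = g} h (suc dg))))
          (deg-* {f = f} (suc df) (dg h))))
    where
    lem : ∀ a b c d → (a - b) * c + b * (c - d) ≡ a * c - b * d
    lem = solve-∀

  deg-^ : ∀ {n a} {f : Vec ℕ n → ℤ} k → Deg< (suc a) f → Deg< (suc (k ℕ.* a)) (λ x → f x ^ k)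
  deg-^ zero    df = deg-const 1ℤ
  deg-^ {a = a} (suc k) df =
    deg-≡ (ℕ.+-suc a (k ℕ.* a)) (deg-* df (deg-^ k df))

  deg-∏< : ∀ {n a} k {f : ℕ → Vec ℕ n → ℤ} → (∀ i → Deg< (suc a) (f i)) →
    Deg< (suc (k ℕ.* a)) (λ x → ∏< k (λ i → f i x))
  deg-∏< zero    df = deg-const 1ℤ
  deg-∏< {a = a} (suc k) df = deg-≡
    (trans (ℕ.+-suc (k ℕ.* a) a) (cong suc (ℕ.+-comm (k ℕ.* a) a))) (deg-* (deg-∏< k df) (df k))

  deg-∑< : ∀ {n m} k {f : ℕ → Vec ℕ n → ℤ} → (∀ i → Deg< m (f i)) →
    Deg< m (λ x → ∑< k (λ i → f i x))
  deg-∑< zero    df = deg-zero _ λ _ → ≋-refl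
  deg-∑< (suc k) df = deg-+ (deg-∑< k df) (df k)

  deg-head : ∀ {n} → Deg< {suc n} 2 (λ x → + V.head x)
  deg-head = suc λ h → deg-cong (λ { (x ∷ _) → ≋-reflexive (lem h x) }) (deg-const (+ V.head h))
    where
    lem : ∀ {n} (h : Vec ℕ (suc n)) x {xs} → + V.head h ≡ + V.head ((x ∷ xs) ⊕ h) - + x
    lem (h ∷ _) x = lem′ (+ h) (+ x)
      where
      lem′ : ∀ a b → a ≡ b + a - b
      lem′ = solve-∀

  deg-tail : ∀ {n m} {f : Vec ℕ n → ℤ} → Deg< m f → Deg< m (f ∘ V.tail)
  deg-tail = deg-∘ V.tail V.tail λ { (_ ∷ _) (_ ∷ _) → refl }

  deg-slice : ∀ {n m} {f : Vec ℕ (suc n) → ℤ} t → Deg< m f → Deg< m (λ y → f (t ∷ y))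
  deg-slice t = deg-∘ (t ∷_) (0 ∷_) λ x h → cong (_∷ x ⊕ h) (sym (ℕ.+-identityʳ t))

  -- Each difference in the first coordinate is traded for one more factor of the weight; once q
  -- differences are spent, no more than the degree of the slices is needed.
  deg-∑-rising : ∀ {n} m k s {g : Vec ℕ (suc n) → ℤ} → m ℕ.+ k ≡ q → Deg< (m ℕ.+ s) g →
    Deg< s (λ y → ∑< p λ t → rising k (suc t) * g (t ∷ y))
  deg-∑-rising zero    k s eq dg = deg-∑< p λ t → deg-scale (rising k (suc t)) (deg-slice t dg)
  deg-∑-rising {n} (suc m) k s {g} eq (suc dg) =
    deg-unscale {a = + suc k} (small≉0 (s≤s z≤n) (s≤s (ℕ.≤-trans (s≤s (ℕ.m≤n+m k m)) (ℕ.≤-reflexive eq))))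
      (deg-cong (λ y → ≋-sym (by-parts y))
        (deg-scale (- 1ℤ) (deg-∑-rising m (suc k) s (trans (ℕ.+-suc m k) eq) (dg e₁))))
    where
    e₁ : Vec ℕ (suc n)
    e₁ = 1 ∷ 0⃗
    ∑-cong : ∀ N {u v : ℕ → ℤ} → (∀ t → u t ≡ v t) → ∑< N u ≡ ∑< N v
    ∑-cong zero    h = refl
    ∑-cong (suc N) h = cong₂ _+_ (∑-cong N h) (h N)
    lem : ∀ a b → a ≡ (a + b) + - 1ℤ * b
    lem = solve-∀
    by-parts : ∀ y → + suc k * ∑< p (λ t → rising k (suc t) * g (t ∷ y))
      ≋ - 1ℤ * ∑< p (λ t → rising (suc k) (suc t) * Δ e₁ g (t ∷ y))
    by-parts y = begin
      a ≡⟨ lem a b ⟩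
      (a + b) + - 1ℤ * b ≡⟨ cong (_+ - 1ℤ * b) (summation-by-parts k (λ t → g (t ∷ y)) p) ⟩
      -- The boundary term `rising (suc k) p * g (p ∷ y)` has the factor p and disappears.
      + p * rising k (suc p) * g (p ∷ y) + - 1ℤ * b
        ≈⟨ +-cong (*-zeroˡ-≋ (g (p ∷ y)) (*-zeroˡ-≋ (rising k (suc p)) p≋0)) ≋-refl ⟩
      0ℤ + - 1ℤ * b ≡⟨ ℤ.+-identityˡ _ ⟩
      - 1ℤ * b ≡⟨ cong (- 1ℤ *_) (∑-cong p λ t → cong (λ z → rising (suc k) (suc t) * (g z - g (t ∷ y)))
                  (cong₂ _∷_ (sym (ℕ.+-comm t 1)) (sym (⊕-identityʳ y)))) ⟩
      - 1ℤ * ∑< p (λ t → rising (suc k) (suc t) * Δ e₁ g (t ∷ y)) ∎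
      where
      open ≋-Reasoning
      a = + suc k * ∑< p (λ t → rising k (suc t) * g (t ∷ y))
      b = ∑< p (λ t → rising (suc k) (suc t) * (g (suc t ∷ y) - g (t ∷ y)))

  ∑<-cong : ∀ N {u v : ℕ → ℤ} → (∀ {t} → t ℕ.< N → u t ≋ v t) → ∑< N u ≋ ∑< N v
  ∑<-cong zero    h = ≋-refl
  ∑<-cong (suc N) h = +-cong (∑<-cong N λ t<N → h (ℕ.m<n⇒m<1+n t<N)) (h ℕ.≤-refl)

  -- The case of weight `rising 0` = 1, with all q differences still to be spent. For s = 0 it says
  -- that a function of degree below q sums to 0 along a coordinate.
  deg-∑ : ∀ {n} s {g : Vec ℕ (suc n) → ℤ} → Deg< (q ℕ.+ s) g → Deg< s (λ y → ∑< p λ t → g (t ∷ y))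
  deg-∑ s {g} dg = deg-cong (λ y → ∑<-cong p λ {t} _ → ≋-reflexive (ℤ.*-identityˡ (g (t ∷ y))))
    (deg-∑-rising q 0 s (ℕ.+-identityʳ q) dg)

  ∑<-single : ∀ N {u : ℕ → ℤ} {a} → a ℕ.< N → (∀ {t} → t ℕ.< N → t ≢ a → u t ≋ 0ℤ) → ∑< N u ≋ u a
  ∑<-single (suc N) {u} {a} a<N h with a ℕ.≟ N
  ... | yes refl = ≋-trans
        (+-cong (∑<-zero N λ t<N → h (ℕ.m<n⇒m<1+n t<N) (ℕ.<⇒≢ t<N)) ≋-refl)
        (≋-reflexive (ℤ.+-identityˡ (u N)))
    where
    ∑<-zero : ∀ N → (∀ {t} → t ℕ.< N → u t ≋ 0ℤ) → ∑< N u ≋ 0ℤ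
    ∑<-zero zero    h = ≋-refl
    ∑<-zero (suc N) h = +-cong (∑<-zero N (h ∘ ℕ.m<n⇒m<1+n)) (h ℕ.≤-refl)
  ... | no a≢N = ≋-trans
        (+-cong (∑<-single N (ℕ.≤∧≢⇒< (ℕ.≤-pred a<N) a≢N) (h ∘ ℕ.m<n⇒m<1+n)) (h ℕ.≤-refl (a≢N ∘ sym)))
        (≋-reflexive (ℤ.+-identityʳ (u a)))

  ∏<-zero : ∀ N {u : ℕ → ℤ} {i} → i ℕ.< N → u i ≋ 0ℤ → ∏< N u ≋ 0ℤ
  ∏<-zero (suc N) {u} {i} i<N ui≋0 with i ℕ.≟ N
  ... | yes refl = *-zeroʳ-≋ (∏< N u) ui≋0
  ... | no i≢N   = *-zeroˡ-≋ (u N) (∏<-zero N (ℕ.≤∧≢⇒< (ℕ.≤-pred i<N) i≢N) ui≋0)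

  ∏<-nonzero : ∀ N {u : ℕ → ℤ} → (∀ {i} → i ℕ.< N → ¬ u i ≋ 0ℤ) → ¬ ∏< N u ≋ 0ℤ
  ∏<-nonzero zero    h ∏≋0 = 1≉0 ∏≋0
  ∏<-nonzero (suc N) h ∏≋0 =
    h ℕ.≤-refl (*-cancel-≋0 (∏<-nonzero N (h ∘ ℕ.m<n⇒m<1+n)) ∏≋0)

  ∏<-cong : ∀ N {u v : ℕ → ℤ} → (∀ i → u i ≋ v i) → ∏< N u ≋ ∏< N v
  ∏<-cong zero    h = ≋-refl
  ∏<-cong (suc N) h = *-cong (∏<-cong N h) (h N)

  -- Residues, power sums and Fermat's little theorem

  residue : ∀ z → Fin p
  residue z = fromℕ< (ℤ.n%ℕd<d z p)

  ≋-residue : ∀ z → z ≋ + toℕ (residue z)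
  ≋-residue z = congruent (divides (z ℤ./ℕ p) (begin
    z - + toℕ (residue z)  ≡⟨ cong₂ (λ a b → a - + b) (ℤ.a≡a%ℕn+[a/ℕn]*n z p) (Fin.toℕ-fromℕ< _) ⟩
    + (z ℤ.%ℕ p) + (z ℤ./ℕ p) * + p - + (z ℤ.%ℕ p)  ≡⟨ lem (+ (z ℤ.%ℕ p)) _ ⟩
    (z ℤ./ℕ p) * + p ∎))
    where
    open ≡-Reasoning
    lem : ∀ a b → a + b - a ≡ b
    lem = solve-∀

  -- With P the product of n factors and L its leading term, the next difference is (P - L)(a X - (n
  -- + 1)) - (n + 1) L, and both parts have degree at most n.
  deg-leading-term : ∀ a n → Deg< {1} n (λ x →
    ∏< n (λ i → a * + V.head x - + suc i) - a ^ n * (+ V.head x) ^ n)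
  deg-leading-term a zero    = zero λ _ → ≋-refl
  deg-leading-term a (suc n) =
    deg-cong (λ x → ≋-reflexive (lem (P x) a (+ V.head x) (+ suc n) (a ^ n) ((+ V.head x) ^ n)))
      (deg-minus
        (deg-≡ (cong ℕ.pred (ℕ.+-comm n 2))
          (deg-* (deg-leading-term a n)
            (deg-minus (deg-scale a deg-head) (deg-mono (s≤s z≤n) (deg-const (+ suc n))))))
        (deg-scale (+ suc n) (deg-scale (a ^ n)
          (deg-≡ (cong suc (ℕ.*-identityʳ n)) (deg-^ n deg-head)))))
    where
    P : Vec ℕ 1 → ℤ
    P x = ∏< n (λ i → a * + V.head x - + suc i)
    lem : ∀ P a X b A Y → (P - A * Y) * (a * X - b) - b * (A * Y) ≡ P * (a * X - b) - a * A * (X * Y)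
    lem = solve-∀

  -- Both ∏ (a t - i) over 0 < i < p, which vanishes for 0 < t < p, and its leading term a^q t^q
  -- have the same sum over t.
  power-sum : ∀ {a} → ¬ a ≋ 0ℤ →
    a ^ q * ∑< p (λ t → (+ t) ^ q) ≋ ∏< q (λ i → 0ℤ - + suc i)
  power-sum {a} a≉0 = begin
    a ^ q * ∑< p (λ t → (+ t) ^ q)     ≡⟨ sym (∑<-distribˡ p (a ^ q) (λ t → (+ t) ^ q)) ⟩
    ∑< p (λ t → a ^ q * (+ t) ^ q)     ≈⟨ ≋-sym (-≋0⇒≋ ∑-diff≋0) ⟩
    ∑< p h                             ≈⟨ ∑<-single p (s≤s z≤n) vanish ⟩
    h 0                                ≈⟨ ∏<-cong q (λ i → ≋-reflexive (cong (_- + suc i) (ℤ.*-zeroʳ a))) ⟩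
    ∏< q (λ i → 0ℤ - + suc i)          ∎
    where
    open ≋-Reasoning
    h : ℕ → ℤ
    h t = ∏< q (λ i → a * + t - + suc i)
    ∑-diff≋0 : ∑< p h - ∑< p (λ t → a ^ q * (+ t) ^ q) ≋ 0ℤ
    ∑-diff≋0 with deg-∑ 0 (deg-≡ (sym (ℕ.+-identityʳ q)) (deg-leading-term a q))
    ... | zero ∑≋0 = ≋-trans (≋-reflexive (sym (∑<-distrib-minus p h _))) (∑≋0 [])
    vanish : ∀ {t} → t ℕ.< p → t ≢ 0 → h t ≋ 0ℤ
    vanish {t} t<p t≢0 with residue (a * + t) | ≋-residue (a * + t)
    ... | Fin.zero  | at≋0 = contradiction (*-cancel-≋0 a≉0 at≋0) (small≉0 (ℕ.n≢0⇒n>0 t≢0) t<p)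
    ... | Fin.suc r | at≋r = ∏<-zero q (Fin.toℕ<n r) (≋⇒-≋0 at≋r)

  -- Let S be the sum of t^q over t. By `power-sum`, a^q S has a value independent of a; for a = 1
  -- the value is S itself. It is nonzero as the product of all -i with 0 < i < p, so S cancels.
  fermat : ∀ {a} → ¬ a ≋ 0ℤ → a ^ q ≋ 1ℤ
  fermat {a} a≉0 = -≋0⇒≋ (*-cancel-≋0 S≉0 (≋-trans (≋-reflexive (lem S (a ^ q)))
    (≋⇒-≋0 (≋-trans (power-sum a≉0) (≋-sym S≋w)))))
    where
    S = ∑< p (λ t → (+ t) ^ q)
    lem : ∀ S b → S * (b - 1ℤ) ≡ b * S - S
    lem = solve-∀
    S≋w : S ≋ ∏< q (λ i → 0ℤ - + suc i)
    S≋w = ≋-trans (≋-reflexive (trans (sym (ℤ.*-identityˡ S)) (cong (_* S) (sym (ℤ.^-zeroˡ q)))))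
      (power-sum 1≉0)
    S≉0 : ¬ S ≋ 0ℤ
    S≉0 S≋0 = ∏<-nonzero q
      (λ {i} i<q -i≋0 → small≉0 (s≤s z≤n) (s≤s i<q)
        (≋-trans (≋-reflexive (lem′ (+ suc i))) (-‿cong -i≋0)))
      (≋-trans (≋-sym S≋w) S≋0)
      where
      lem′ : ∀ a → a ≡ - (0ℤ - a)
      lem′ = solve-∀

  -- Supports in F_p^n and a lower bound for their size

  nonzero : ℤ → Bool
  nonzero z = not ⌊ + p ∣? z ⌋

  nonzero⇒≉0 : ∀ {z} → nonzero z ≡ true → ¬ z ≋ 0ℤ
  nonzero⇒≉0 {z} eq z≋0 with + p ∣? z
  ... | no p∤z = p∤z (≋0⇒∣ z≋0)

  ≉0⇒nonzero : ∀ {z} → ¬ z ≋ 0ℤ → nonzero z ≡ true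
  ≉0⇒nonzero {z} z≉0 with + p ∣? z
  ... | yes p∣z = contradiction (∣⇒≋0 p∣z) z≉0
  ... | no _    = refl

  nonzero≡false⇒≋0 : ∀ {z} → nonzero z ≡ false → z ≋ 0ℤ
  nonzero≡false⇒≋0 {z} eq with + p ∣? z
  ... | yes p∣z = ∣⇒≋0 p∣z

  ≋0⇒nonzero≡false : ∀ {z} → z ≋ 0ℤ → nonzero z ≡ false
  ≋0⇒nonzero≡false {z} z≋0 with + p ∣? z
  ... | yes _   = refl
  ... | no  p∤z = contradiction (≋0⇒∣ z≋0) p∤z

  coords : ∀ {n} → Vec (Fin p) n → Vec ℕ n
  coords = V.map toℕ

  support : ∀ {n} → (Vec ℕ n → ℤ) → Subset p n
  support g y = nonzero (g (coords y))

  ∏[t-_] : List (Fin p) → ℕ → ℤ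
  ∏[t- []     ] t = 1ℤ
  ∏[t- a ∷ as ] t = (+ t - + toℕ a) * ∏[t- as ] t

  deg-∏[t-] : ∀ {n} as → Deg< {suc n} (suc (length as)) (λ x → ∏[t- as ] (V.head x))
  deg-∏[t-] []       = deg-const 1ℤ
  deg-∏[t-] (a ∷ as) =
    deg-* (deg-minus deg-head (deg-mono (s≤s z≤n) (deg-const (+ toℕ a)))) (deg-∏[t-] as)

  ∏[t-]-zero : ∀ {a as} → a ∈ as → ∏[t- as ] (toℕ a) ≋ 0ℤ
  ∏[t-]-zero {a} {_ ∷ as} (here refl) = *-zeroˡ-≋ (∏[t- as ] (toℕ a)) (≋⇒-≋0 (≋-refl {+ toℕ a}))
  ∏[t-]-zero {a} {b ∷ as} (there a∈as) = *-zeroʳ-≋ (+ toℕ a - + toℕ b) (∏[t-]-zero a∈as)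

  ∀<-by-Fin : ∀ (P : ℕ → Set) → (∀ (i : Fin p) → P (toℕ i)) → ∀ {t} → t ℕ.< p → P t
  ∀<-by-Fin P h t<p = subst P (Fin.toℕ-fromℕ< t<p) (h (fromℕ< t<p))

  +-injective-≋-≤ : ∀ {a b} → a ℕ.≤ b → b ℕ.< p → + b ≋ + a → b ≡ a
  +-injective-≋-≤ {a} {b} a≤b b<p b≋a with b ℕ.∸ a in eq
  ... | zero  = ℕ.≤-antisym (ℕ.m∸n≡0⇒m≤n eq) a≤b
  ... | suc d = contradiction
    (≋-trans (≋-reflexive (trans (cong +_ (sym eq)) (trans (sym (ℤ.⊖-≥ a≤b)) (sym (ℤ.m-n≡m⊖n b a)))))
      (≋⇒-≋0 b≋a))
    (small≉0 (s≤s z≤n) (ℕ.≤-<-trans (subst (ℕ._≤ b) eq (ℕ.m∸n≤m b a)) b<p))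

  +-injective-≋ : ∀ {a b} → a ℕ.< p → b ℕ.< p → + a ≋ + b → a ≡ b
  +-injective-≋ {a} {b} a<p b<p a≋b with ℕ.≤-total a b
  ... | inj₁ a≤b = sym (+-injective-≋-≤ a≤b b<p (≋-sym a≋b))
  ... | inj₂ b≤a = +-injective-≋-≤ b≤a a<p a≋b

  ∏[t-]-nonzero : ∀ {a} as → ¬ a ∈ as → ¬ ∏[t- as ] (toℕ a) ≋ 0ℤ
  ∏[t-]-nonzero [] _ = 1≉0
  ∏[t-]-nonzero {a} (b ∷ as) a∉ ∏≋0 = ∏[t-]-nonzero as (a∉ ∘ there)
    (*-cancel-≋0 (λ a-b≋0 → a∉ (here (Fin.toℕ-injective
      (+-injective-≋ (Fin.toℕ<n a) (Fin.toℕ<n b) (-≋0⇒≋ a-b≋0))))) ∏≋0)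

  -- Abstract, as unfolding card makes conversion checking very slow.
  abstract
    ∣supp∣ : ∀ {n} → (Vec ℕ n → ℤ) → ℕ
    ∣supp∣ {n} g = card p n (support g)

    ∣supp∣≡card : ∀ {n} (g : Vec ℕ n → ℤ) → ∣supp∣ g ≡ card p n (support g)
    ∣supp∣≡card g = refl

    ∣supp∣-slices : ∀ {n} (g : Vec ℕ (suc n) → ℤ) →
      ∣supp∣ g ≡ sum (map (λ i → ∣supp∣ (λ y → g (toℕ i ∷ y))) (allFin p))
    ∣supp∣-slices g = card-suc (support g)

    ∣supp∣-mono : ∀ {n} (f g : Vec ℕ n → ℤ) →
      (∀ y → ¬ f (coords y) ≋ 0ℤ → ¬ g (coords y) ≋ 0ℤ) → ∣supp∣ f ℕ.≤ ∣supp∣ g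
    ∣supp∣-mono f g h = card-mono λ y fy → ≉0⇒nonzero (h y (nonzero⇒≉0 fy))

    ∣supp∣-pos : ∀ {n} (g : Vec ℕ n → ℤ) y → ¬ g (coords y) ≋ 0ℤ → 0 ℕ.< ∣supp∣ g
    ∣supp∣-pos g y g≉0 = card-pos (support g) y (≉0⇒nonzero g≉0)

    ∣supp∣≯0 : ∀ {n} (g : Vec ℕ n → ℤ) → ¬ 0 ℕ.< ∣supp∣ g → ∀ y → g (coords y) ≋ 0ℤ
    ∣supp∣≯0 g ≯0 y = nonzero≡false⇒≋0 (Bool.¬-not λ eq → ≯0 (card-pos (support g) y eq))

    ∣supp∣-zero : ∀ {n} (g : Vec ℕ n → ℤ) → (∀ y → g y ≋ 0ℤ) → ∣supp∣ g ≡ 0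
    ∣supp∣-zero g g≋0 = card-empty (support g) λ y → ≋0⇒nonzero≡false (g≋0 (coords y))

  -- The arithmetic of the induction step of `∣supp∣-bound`, with c the size of the isolated slice
  -- and E = p^(n q). Of the factor p^q, the part p^k is absorbed by (k + 1)^q, and the part p^(q -
  -- k) by the drop of the degree from D to s.
  slice-bound : ∀ {k D s} c → k ℕ.≤ q → D ≡ (q ℕ.∸ k) ℕ.+ s → ∀ E →
    E ℕ.≤ c ℕ.^ q ℕ.* p ℕ.^ s → p ℕ.^ q ℕ.* E ℕ.≤ (suc k ℕ.* c) ℕ.^ q ℕ.* p ℕ.^ D
  slice-bound {k} {s = s} c k≤q refl E E≤ = begin
    p ℕ.^ q ℕ.* E                             ≡⟨ cong (λ m → p ℕ.^ m ℕ.* E) (sym (ℕ.m+[n∸m]≡n k≤q)) ⟩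
    p ℕ.^ (k ℕ.+ j) ℕ.* E                     ≡⟨ cong (ℕ._* E) (ℕ.^-distribˡ-+-* p k j) ⟩
    p ℕ.^ k ℕ.* p ℕ.^ j ℕ.* E                 ≤⟨ ℕ.*-mono-≤ (ℕ.*-monoˡ-≤ (p ℕ.^ j) ([1+q]^k≤[1+k]^q k≤q)) E≤ ⟩
    suc k ℕ.^ q ℕ.* p ℕ.^ j ℕ.* (c ℕ.^ q ℕ.* p ℕ.^ s)
      ≡⟨ lem (suc k ℕ.^ q) (p ℕ.^ j) (c ℕ.^ q) (p ℕ.^ s) ⟩
    (suc k ℕ.^ q ℕ.* c ℕ.^ q) ℕ.* (p ℕ.^ j ℕ.* p ℕ.^ s)
      ≡⟨ cong₂ ℕ._*_ (sym (^-distribʳ-* q (suc k) c)) (sym (ℕ.^-distribˡ-+-* p j s)) ⟩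
    (suc k ℕ.* c) ℕ.^ q ℕ.* p ℕ.^ (j ℕ.+ s)   ∎
    where
    open ℕ.≤-Reasoning
    j = q ℕ.∸ k
    lem : ∀ a b c d → a ℕ.* b ℕ.* (c ℕ.* d) ≡ (a ℕ.* c) ℕ.* (b ℕ.* d)
    lem = solveℕ-∀

  -- If g vanishes on all slices outside as and {a}, the product kills the slices in as, so that
  -- the sum is a multiple of the slice at a, of lower degree than the slice itself seems to have.
  isolate : ∀ {n} → List (Fin p) → (Vec ℕ (suc n) → ℤ) → Vec ℕ n → ℤ
  isolate as g y = ∑< p λ t → ∏[t- as ] t * g (t ∷ y)

  deg-isolate : ∀ {n b s} as {g : Vec ℕ (suc n) → ℤ} → length as ℕ.+ b ℕ.≤ q ℕ.+ s →
    Deg< b g → Deg< s (isolate as g)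
  deg-isolate {s = s} as {g} le dg = deg-∑ s {λ x → ∏[t- as ] (V.head x) * g x}
    (deg-mono le (deg-* (deg-∏[t-] as) dg))

  isolate-≋ : ∀ {n a as} (g : Vec ℕ (suc n) → ℤ) →
    (∀ i → i ≢ a → i ∈ as ⊎ (∀ y → g (toℕ i ∷ coords y) ≋ 0ℤ)) →
    ∀ y → isolate as g (coords y) ≋ ∏[t- as ] (toℕ a) * g (toℕ a ∷ coords y)
  isolate-≋ {a = a} {as} g cover y = ∑<-single p (Fin.toℕ<n a)
    (∀<-by-Fin (λ t → t ≢ toℕ a → ∏[t- as ] t * g (t ∷ coords y) ≋ 0ℤ) λ i i≢a → vanish i (i≢a ∘ cong toℕ))
    where
    vanish : ∀ i → i ≢ a → ∏[t- as ] (toℕ i) * g (toℕ i ∷ coords y) ≋ 0ℤ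
    vanish i i≢a with cover i i≢a
    ... | inj₁ i∈as = *-zeroˡ-≋ (g (toℕ i ∷ coords y)) (∏[t-]-zero i∈as)
    ... | inj₂ g≋0  = *-zeroʳ-≋ (∏[t- as ] (toℕ i)) (g≋0 y)

  ∣slice∣ : ∀ {n} → (Vec ℕ (suc n) → ℤ) → Fin p → ℕ
  ∣slice∣ g i = ∣supp∣ (λ y → g (toℕ i ∷ y))

  ∣supp∣-isolate : ∀ {n a as} (g : Vec ℕ (suc n) → ℤ) → ¬ a ∈ as →
    (∀ i → i ≢ a → i ∈ as ⊎ (∀ y → g (toℕ i ∷ coords y) ≋ 0ℤ)) →
    ∣supp∣ (isolate as g) ≡ ∣slice∣ g a
  ∣supp∣-isolate {a = a} {as} g a∉as cover = ℕ.≤-antisym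
    (∣supp∣-mono (isolate as g) (λ y → g (toℕ a ∷ y)) λ y G≉0 g≋0 →
      G≉0 (≋-trans (isolate-≋ g cover y) (*-zeroʳ-≋ (∏[t- as ] (toℕ a)) g≋0)))
    (∣supp∣-mono (λ y → g (toℕ a ∷ y)) (isolate as g) λ y g≉0 G≋0 →
      g≉0 (*-cancel-≋0 (∏[t-]-nonzero as a∉as) (≋-trans (≋-sym (isolate-≋ g cover y)) G≋0)))

  -- In `dominantSlice`, `index` is the smallest nonempty slice, `others` lists the remaining
  -- nonempty ones, and there are k + 1 in all. Isolating the slice takes at most k linear factors,
  -- while the whole support is at least k + 1 times as large as the slice.
  record DominantSlice {n} (g : Vec ℕ (suc n) → ℤ) : Set where
    field
      {index}  : Fin p
      {others} : List (Fin p)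
      {k}      : ℕ
      k≤q      : k ℕ.≤ q
      others≤k : length others ℕ.≤ k
      index∉   : ¬ index ∈ others
      cover    : ∀ i → i ≢ index → i ∈ others ⊎ (∀ y → g (toℕ i ∷ coords y) ≋ 0ℤ)
      positive : 0 ℕ.< ∣slice∣ g index
      bound    : suc k ℕ.* ∣slice∣ g index ℕ.≤ ∣supp∣ g

  dominantSlice : ∀ {n} (g : Vec ℕ (suc n) → ℤ) → 0 ℕ.< ∣supp∣ g → DominantSlice g
  dominantSlice {n} g pos with length*min≤sum (∣slice∣ g) (allFin p)
  ... | inj₁ ∑≡0 = contradiction (trans (∣supp∣-slices g) ∑≡0) (ℕ.>⇒≢ pos)
  ... | inj₂ (a , a∈A , |A|ca≤) = record
    { k≤q      = ℕ.pred-mono-≤ length-A≤p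
    ; others≤k = ℕ.≤-pred (ℕ.≤-trans length-A′<length-A (ℕ.≤-reflexive (sym 1+k≡)))
    ; index∉   = λ a∈A′ → proj₂ (∈-filter⁻ ≢a? {xs = A} a∈A′) refl
    ; cover    = cover
    ; positive = proj₂ (∈-filter⁻ pos? {xs = allFin p} a∈A)
    ; bound    = ℕ.≤-trans (ℕ.≤-reflexive (cong (ℕ._* ∣slice∣ g a) 1+k≡))
        (ℕ.≤-trans |A|ca≤ (ℕ.≤-reflexive (sym (∣supp∣-slices g))))
    }
    where
    pos? = λ i → 0 ℕ.<? ∣slice∣ g i
    ≢a? = λ i → ¬? (i Fin.≟ a)
    A = filter pos? (allFin p)
    length-A≤p : length A ℕ.≤ p
    length-A≤p = ℕ.≤-trans (L.length-filter pos? (allFin p)) (ℕ.≤-reflexive (L.length-tabulate {n = p} (λ i → i)))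
    length-A′<length-A : length (filter ≢a? A) ℕ.< length A
    length-A′<length-A = L.filter-notAll ≢a? A (Any.map (λ { refl ¬a≡a → ¬a≡a refl }) a∈A)
    1+k≡ : suc (ℕ.pred (length A)) ≡ length A
    1+k≡ = ℕ.suc-pred (length A) {{ℕ.>-nonZero (ℕ.≤-<-trans z≤n length-A′<length-A)}}
    cover : ∀ i → i ≢ a → i ∈ filter ≢a? A ⊎ (∀ y → g (toℕ i ∷ coords y) ≋ 0ℤ)
    cover i i≢a with pos? i
    ... | yes 0<ci = inj₁ (∈-filter⁺ ≢a? (∈-filter⁺ pos? (∈-allFin i) 0<ci) i≢a)
    ... | no  ci≯0 = inj₂ (∣supp∣≯0 (λ y → g (toℕ i ∷ y)) ci≯0)

  -- The minimum is (p - b) p^(n - 1 - a) for D = a q + b with b < q. The q-th power of the weaker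
  -- bound p^(n - D / q), which is attained for b = 0, spares the division.
  ∣supp∣-bound : ∀ n D {g : Vec ℕ n → ℤ} → Deg< (suc D) g → 0 ℕ.< ∣supp∣ g →
    p ℕ.^ (n ℕ.* q) ℕ.≤ ∣supp∣ g ℕ.^ q ℕ.* p ℕ.^ D
  ∣supp∣-bound zero D {g} dg pos = ℕ.*-mono-≤
    (ℕ.m^n>0 (∣supp∣ g) {{ℕ.>-nonZero pos}} q) (ℕ.m^n>0 p D)
  ∣supp∣-bound (suc n) D {g} dg pos = by-degree (D ℕ.<? j)
    where
    open DominantSlice (dominantSlice g pos)
    open ℕ.≤-Reasoning
    j = q ℕ.∸ k
    G = isolate others g
    |G|≡ : ∣supp∣ G ≡ ∣slice∣ g index
    |G|≡ = ∣supp∣-isolate g index∉ cover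
    0<|G| : 0 ℕ.< ∣supp∣ G
    0<|G| = subst (0 ℕ.<_) (sym |G|≡) positive
    by-degree : Dec (D ℕ.< j) → p ℕ.^ (suc n ℕ.* q) ℕ.≤ ∣supp∣ g ℕ.^ q ℕ.* p ℕ.^ D
    -- Here the degree of `G` would be negative, so `G` would vanish, but its support is as large as
    -- a nonempty slice.
    by-degree (yes D<j) = contradiction (sym (∣supp∣-zero G
      (deg<0 (deg-isolate others (begin
        length others ℕ.+ suc D   ≤⟨ ℕ.+-mono-≤ others≤k D<j ⟩
        k ℕ.+ j                   ≡⟨ ℕ.m+[n∸m]≡n k≤q ⟩
        q                         ≡⟨ ℕ.+-identityʳ q ⟨
        q ℕ.+ 0                   ∎) dg)))) (ℕ.<⇒≢ 0<|G|)
    by-degree (no D≮j) = begin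
      p ℕ.^ (q ℕ.+ n ℕ.* q)                   ≡⟨ ℕ.^-distribˡ-+-* p q (n ℕ.* q) ⟩
      p ℕ.^ q ℕ.* p ℕ.^ (n ℕ.* q)             ≤⟨ slice-bound (∣slice∣ g index) k≤q D≡ (p ℕ.^ (n ℕ.* q)) IH ⟩
      (suc k ℕ.* ∣slice∣ g index) ℕ.^ q ℕ.* p ℕ.^ D
        ≤⟨ ℕ.*-monoˡ-≤ (p ℕ.^ D) (ℕ.^-monoˡ-≤ q bound) ⟩
      ∣supp∣ g ℕ.^ q ℕ.* p ℕ.^ D ∎
      where
      s = D ℕ.∸ j
      D≡ : D ≡ j ℕ.+ s
      D≡ = sym (ℕ.m+[n∸m]≡n (ℕ.≮⇒≥ D≮j))
      -- The factors for `others` add at most k to the degree D and the summation removes q, which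
      -- leaves s = D - (q - k).
      deg-G : Deg< (suc s) G
      deg-G = deg-isolate others (begin
        length others ℕ.+ suc D   ≤⟨ ℕ.+-mono-≤ others≤k (ℕ.≤-reflexive (cong suc D≡)) ⟩
        k ℕ.+ suc (j ℕ.+ s)       ≡⟨ cong (k ℕ.+_) (ℕ.+-suc j s) ⟨
        k ℕ.+ (j ℕ.+ suc s)       ≡⟨ ℕ.+-assoc k j (suc s) ⟨
        k ℕ.+ j ℕ.+ suc s         ≡⟨ cong (ℕ._+ suc s) (ℕ.m+[n∸m]≡n k≤q) ⟩
        q ℕ.+ suc s               ∎) dg
      IH : p ℕ.^ (n ℕ.* q) ℕ.≤ ∣slice∣ g index ℕ.^ q ℕ.* p ℕ.^ s
      IH = subst (λ m → p ℕ.^ (n ℕ.* q) ℕ.≤ m ℕ.^ q ℕ.* p ℕ.^ s) |G|≡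
        (∣supp∣-bound n s deg-G 0<|G|)

  -- Forms as functions modulo p

  deg-form : ∀ m k c → Deg< (suc k) (form m k c)
  deg-form zero    k       c = deg-scale (c Fin.zero) (deg-≡ (cong suc (ℕ.*-identityʳ k)) (deg-^ k deg-head))
  deg-form (suc m) zero    c = deg-const (c Fin.zero)
  deg-form (suc m) (suc k) c =
    deg-+ (deg-tail (deg-form m (suc k) _)) (deg-* deg-head (deg-form (suc m) k _))

  form-cong : ∀ m k c {x y} → Pointwise (λ a b → + a ≋ + b) x y → form m k c x ≋ form m k c y
  form-cong zero    k       c (x≋y ∷ [])  = *-cong (≋-refl {c Fin.zero}) (^-cong k x≋y)
  form-cong (suc m) zero    c _           = ≋-refl
  form-cong (suc m) (suc k) c (x≋y ∷ xs≋ys) =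
    +-cong (form-cong m (suc k) _ xs≋ys) (*-cong x≋y (form-cong (suc m) k _ (x≋y ∷ xs≋ys)))

  -- Setting x₁ = 0 shows that f₀ vanishes; then x₁ f₁ vanishes everywhere, and the claim reduces to
  -- f₁. The degree has to be bounded: x^p y - x y^p vanishes at all points without being the zero
  -- form.
  form-independent : ∀ m k c → k ℕ.≤ q → (∀ y → form m k c (coords y) ≋ 0ℤ) → ∀ i → c i ≋ 0ℤ
  form-independent zero k c k≤q f≋0 Fin.zero = ≋-trans (≋-reflexive (sym c*1≡c)) (f≋0 (fromℕ< 1<p ∷ []))
    where
    c*1≡c : c Fin.zero * (+ toℕ (fromℕ< 1<p)) ^ k ≡ c Fin.zero
    c*1≡c = trans (cong (λ t → c Fin.zero * (+ t) ^ k) (Fin.toℕ-fromℕ< 1<p))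
      (trans (cong (c Fin.zero *_) (ℤ.^-zeroˡ k)) (ℤ.*-identityʳ (c Fin.zero)))
  form-independent (suc m) zero c k≤q f≋0 Fin.zero = f≋0 (replicate _ Fin.zero)
  form-independent (suc m) (suc k) c k<q f≋0 i =
    subst (λ i → c i ≋ 0ℤ) (Fin.join-splitAt (dim m (suc k)) (dim (suc m) k) i)
      (by-summand (Fin.splitAt (dim m (suc k)) i))
    where
    c₀ = λ i → c (i ↑ˡ dim (suc m) k)
    c₁ = λ i → c (dim m (suc k) ↑ʳ i)
    f₀ = form m (suc k) c₀
    f₁ = form (suc m) k c₁
    f₀≋0 : ∀ y → f₀ (coords y) ≋ 0ℤ
    f₀≋0 y = ≋-trans
      (≋-reflexive (trans (sym (ℤ.+-identityʳ (f₀ (coords y))))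
        (cong (λ z → f₀ (coords y) + z) (sym (ℤ.*-zeroˡ (f₁ (0 ∷ coords y)))))))
      (f≋0 (Fin.zero ∷ y))
    x*f₁≋0 : ∀ t y → + toℕ t * f₁ (toℕ t ∷ coords y) ≋ 0ℤ
    x*f₁≋0 t y = ≋-trans (≋-reflexive (sym (ℤ.+-identityˡ _)))
      (≋-trans (+-cong (≋-sym (f₀≋0 y)) ≋-refl) (f≋0 (t ∷ y)))
    f₁≋0-off-0 : ∀ t y → t ≢ Fin.zero → f₁ (toℕ t ∷ coords y) ≋ 0ℤ
    f₁≋0-off-0 Fin.zero    y t≢0 = contradiction refl t≢0
    f₁≋0-off-0 (Fin.suc t) y _   = *-cancel-≋0 (small≉0 (s≤s z≤n) (Fin.toℕ<n (Fin.suc t))) (x*f₁≋0 (Fin.suc t) y)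
    -- Where x₁ = 0 nothing can be cancelled, but f₁ has degree < q and thus sums to 0 along x₁.
    f₁≋0 : ∀ y → f₁ (coords y) ≋ 0ℤ
    f₁≋0 (Fin.suc t ∷ y) = f₁≋0-off-0 (Fin.suc t) y λ ()
    f₁≋0 (Fin.zero ∷ y) = ≋-trans
      (≋-sym (∑<-single p {λ t → f₁ (t ∷ coords y)} (s≤s z≤n)
        (∀<-by-Fin (λ t → t ≢ 0 → f₁ (t ∷ coords y) ≋ 0ℤ) λ t t≢0 → f₁≋0-off-0 t y (t≢0 ∘ cong toℕ))))
      (deg<0 (deg-∑ 0 (deg-mono (ℕ.≤-trans k<q (ℕ.≤-reflexive (sym (ℕ.+-identityʳ q)))) (deg-form (suc m) k c₁))) (coords y))
    by-summand : ∀ j → c (Fin.join (dim m (suc k)) (dim (suc m) k) j) ≋ 0ℤ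
    by-summand (inj₁ j) = form-independent m (suc k) c₀ k<q f₀≋0 j
    by-summand (inj₂ j) = form-independent (suc m) k c₁ (ℕ.<⇒≤ k<q) f₁≋0 j

  VanishingForm : ∀ m k → Subset p (suc m) → Set
  VanishingForm m k D = ∃ λ c →
    (∀ d → D d ≡ true → form m k c (coords d) ≋ 0ℤ) × ∃ λ v → ¬ form m k c (coords v) ≋ 0ℤ

  -- Pigeonhole: there are p^(dim m k) coefficient vectors with entries in F_p but only p^|D|
  -- families of values on D. Two distinct vectors with equal values have a difference that vanishes
  -- on D.
  ∃-vanishing-form : ∀ m k → k ℕ.≤ q → (D : Subset p (suc m)) → card p (suc m) D ℕ.< dim m k →
    VanishingForm m k D
  ∃-vanishing-form m k k≤q D |D|<dim
    with Fin.pigeonhole (ℕ.^-monoʳ-< p 1<p |D|<dim) values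
    where
    values : Fin (p ℕ.^ dim m k) → Fin (p ℕ.^ card p (suc m) D)
    values a = funToFin λ j → residue
      (form m k (λ i → + toℕ (finToFun {p} a i)) (coords (lookup (filterᵇ D (allPts p (suc m))) j)))
  ... | a , b , a<b , values≡ = c , c-vanishes , c-nonzero (inhabited? (suc m) (support (form m k c)))
    where
    ca cb c : Fin (dim m k) → ℤ
    ca i = + toℕ (finToFun {p} {dim m k} a i)
    cb i = + toℕ (finToFun {p} {dim m k} b i)
    c i = ca i - cb i
    Ds = filterᵇ D (allPts p (suc m))
    c-vanishes : ∀ d → D d ≡ true → form m k c (coords d) ≋ 0ℤ
    c-vanishes d Dd = ≋-trans (≋-reflexive (form-minus m k ca cb (coords d)))
      (≋⇒-≋0 (≋-trans (≋-residue (form m k ca (coords d)))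
        (≋-trans (≋-reflexive (cong (+_ ∘ toℕ) residue≡)) (≋-sym (≋-residue (form m k cb (coords d)))))))
      where
      d∈Ds : d ∈ Ds
      d∈Ds = ∈-filter⁺ (Bool.T? ∘ D) (∈-allPts d) (Equivalence.from Bool.T-≡ Dd)
      residue≡ : residue (form m k ca (coords d)) ≡ residue (form m k cb (coords d))
      residue≡ = subst (λ e → residue (form m k ca (coords e)) ≡ residue (form m k cb (coords e)))
        (sym (lookup-index d∈Ds))
        (trans (sym (Fin.finToFun-funToFin _ (Any.index d∈Ds)))
          (trans (cong (λ r → finToFun r (Any.index d∈Ds)) values≡) (Fin.finToFun-funToFin _ (Any.index d∈Ds))))
    c-nonzero : Dec (∃ λ v → support (form m k c) v ≡ true) → ∃ λ v → ¬ form m k c (coords v) ≋ 0ℤ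
    c-nonzero (yes (v , eq)) = v , nonzero⇒≉0 eq
    -- If the difference vanished at all points, its coefficients would be 0 modulo p. The two
    -- vectors consist of reduced residues, so they would coincide.
    c-nonzero (no ∄v) = contradiction
      (finToFun-injective {dim m k} {p} λ i → Fin.toℕ-injective (+-injective-≋ (Fin.toℕ<n _) (Fin.toℕ<n _)
        (-≋0⇒≋ (form-independent m k c k≤q (λ y → nonzero≡false⇒≋0 (Bool.¬-not λ eq → ∄v (y , eq))) i))))
      (Fin.<⇒≢ a<b)

  coords-pointOnLine : ∀ {n} (x d : Pt p n) l →
    Pointwise (λ a b → + a ≋ + b) (coords (pointOnLine p x l d)) (line (toℕ l) (coords x) (coords d))
  coords-pointOnLine []      []      l = []
  coords-pointOnLine (x ∷ xs) (d ∷ ds) l = x+ld ∷ coords-pointOnLine xs ds l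
    where
    open ≋-Reasoning
    x+ld : + toℕ (addF p x (mulF p l d)) ≋ + (toℕ x ℕ.+ toℕ l ℕ.* toℕ d)
    x+ld = begin
      + toℕ (addF p x (mulF p l d))   ≈⟨ ≋-residue (+ (toℕ x ℕ.+ toℕ (mulF p l d))) ⟨
      + toℕ x + + toℕ (mulF p l d)    ≈⟨ +-cong (≋-refl {+ toℕ x}) (≋-residue (+ (toℕ l ℕ.* toℕ d))) ⟨
      + toℕ x + + (toℕ l ℕ.* toℕ d)   ∎

  0<q : 0 ℕ.< q
  0<q = ℕ.≤-pred 1<p

  ^q-zero : ∀ {a} → a ≋ 0ℤ → a ^ q ≋ 0ℤ
  ^q-zero {a} a≋0 = subst (λ k → a ^ k ≋ 0ℤ) (ℕ.suc-pred q {{ℕ.>-nonZero 0<q}}) (*-zeroˡ-≋ _ a≋0)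

  -- The rectangle and its lines

  module Lines {n} (f : Vec ℕ n → ℤ) (deg-f : Deg< p f)
    (f-homogeneous : ∀ l x → f (l ⊙ x) ≡ (+ l) ^ q * f x)
    (f-cong : ∀ {x y} → Pointwise (λ a b → + a ≋ + b) x y → f x ≋ f y)
    (v : Pt p n) (fv≉0 : ¬ f (coords v) ≋ 0ℤ) where

    c : ℤ
    c = f (coords v)

    value : ℕ → ℤ
    value zero    = 0ℤ
    value (suc _) = c

    level : ℤ → Subset p n
    level a x = not (nonzero (f (coords x) - a))

    level-elim : ∀ {a x} → level a x ≡ true → f (coords x) ≋ a
    level-elim eq = -≋0⇒≋ (nonzero≡false⇒≋0 (Bool.not-injective eq))

    level-intro : ∀ {a x} → f (coords x) ≋ a → level a x ≡ true
    level-intro fx≋a = cong not (≋0⇒nonzero≡false (≋⇒-≋0 fx≋a))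

    T₁ T₂ : Subset p n
    T₁ = level 0ℤ
    T₂ = level c

    disjoint : ∀ x → T₁ x ≡ true → T₂ x ≡ false
    disjoint x x∈T₁ = Bool.¬-not λ x∈T₂ →
      fv≉0 (≋-trans (≋-sym (level-elim {c} {x} x∈T₂)) (level-elim {0ℤ} {x} x∈T₁))

    rect12-level : ∀ l x → rect12 T₁ T₂ l x ≡ level (value (toℕ l)) x
    rect12-level Fin.zero    x = refl
    rect12-level (Fin.suc _) x = refl

    onLine : ℕ → Pt p n → Pt p n → ℤ
    onLine l x d = f (line l (coords x) (coords d))

    contains-elim : ∀ {x d} → containsLine p (rect12 T₁ T₂) x d ≡ true →
      ∀ l → onLine (toℕ l) x d ≋ value (toℕ l)
    contains-elim {x} {d} eq l = ≋-trans (≋-sym (f-cong (coords-pointOnLine x d l)))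
      (level-elim {x = pointOnLine p x l d}
        (trans (sym (rect12-level l (pointOnLine p x l d))) (allᵇ-elim eq (∈-allFin l))))

    contains-intro : ∀ {x d} → (∀ l → onLine (toℕ l) x d ≋ value (toℕ l)) →
      containsLine p (rect12 T₁ T₂) x d ≡ true
    contains-intro {x} {d} h = allᵇ-intro (allFin p) λ l →
      trans (rect12-level l (pointOnLine p x l d))
        (level-intro {x = pointOnLine p x l d} (≋-trans (f-cong (coords-pointOnLine x d l)) (h l)))

    -- As a function of (l , x), f(x + l d) has degree less than p = q + 1. The sum over l then has
    -- degree less than 1, so that all its differences vanish.
    ∑-line-constant : ∀ d x → ∑< p (λ l → f (line l x d)) ≋ ∑< p (λ l → f (line l 0⃗ d))
    ∑-line-constant d x with deg-∑ 1 {λ z → f (line (V.head z) (V.tail z) d)}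
      (deg-≡ (ℕ.+-comm 1 q) (deg-∘ A A (λ { (l ∷ x) (l′ ∷ h) → line-⊕-+ l l′ x h d }) deg-f))
      where
      A : Vec ℕ (suc n) → Vec ℕ n
      A z = line (V.head z) (V.tail z) d
    ... | suc ΔG≋0 = subst (λ y → ∑< p (λ l → f (line l y d)) ≋ ∑< p (λ l → f (line l 0⃗ d)))
      (⊕-identityˡ x) (-≋0⇒≋ (deg<0 (ΔG≋0 x) 0⃗))

    f-ray : ∀ l d → f (line l 0⃗ d) ≡ (+ l) ^ q * f d
    f-ray l d = trans (cong f (⊕-identityˡ (l ⊙ d))) (f-homogeneous l d)

    ∑-value : ∀ m → ∑< (suc m) value ≡ + m * c
    ∑-value zero    = sym (ℤ.*-zeroˡ c)
    ∑-value (suc m) = trans (cong (_+ c) (∑-value m)) (lem (+ m) c)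
      where
      lem : ∀ m c → m * c + c ≡ (1ℤ + m) * c
      lem = solve-∀

    no-line : ∀ x d → f (coords d) ≋ 0ℤ → containsLine p (rect12 T₁ T₂) x d ≡ false
    -- As 0 < q < p, the factor q is invertible, and q c ≋ 0 contradicts c ≉ 0.
    no-line x d fd≋0 = Bool.¬-not λ eq → fv≉0 (*-cancel-≋0 (small≉0 0<q ℕ.≤-refl) (begin
      + q * c                                          ≡⟨ ∑-value q ⟨
      ∑< p value                                       ≈⟨ ∑<-cong p (≋-sym ∘
        ∀<-by-Fin (λ l → onLine l x d ≋ value l) (contains-elim {x} {d} eq)) ⟩
      ∑< p (λ l → onLine l x d)                        ≈⟨ ∑-line-constant (coords d) (coords x) ⟩
      ∑< p (λ l → f (line l 0⃗ (coords d)))             ≈⟨ ∑<-cong p (λ {l} _ → ≋-trans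
        (≋-reflexive (trans (f-ray l (coords d)) (ℤ.*-comm ((+ l) ^ q) (f (coords d)))))
        (*-cong fd≋0 (≋-refl {(+ l) ^ q}))) ⟩
      ∑< p (λ l → 0ℤ * (+ l) ^ q)                      ≡⟨ ∑<-distribˡ p 0ℤ (λ l → (+ l) ^ q) ⟩
      0ℤ * ∑< p (λ l → (+ l) ^ q)                      ≡⟨ ℤ.*-zeroˡ (∑< p (λ l → (+ l) ^ q)) ⟩
      0ℤ ∎))
      where open ≋-Reasoning

    factor : ℕ → Vec ℕ (n ℕ.+ n) → ℤ
    factor l z = 1ℤ - (f (line l (V.take n z) (V.drop n z)) - value l) ^ q

    indicator : Vec ℕ (n ℕ.+ n) → ℤ
    indicator z = ∏< p λ l → factor l z

    deg-indicator : Deg< (suc (p ℕ.* (q ℕ.* q))) indicator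
    deg-indicator = deg-∏< p λ l →
      deg-minus (deg-mono (s≤s z≤n) (deg-const 1ℤ))
        (deg-^ q (deg-minus (deg-∘ (A l) (A l) (A-linear l) deg-f) (deg-mono (s≤s z≤n) (deg-const (value l)))))
      where
      A : ℕ → Vec ℕ (n ℕ.+ n) → Vec ℕ n
      A l z = line l (V.take n z) (V.drop n z)
      A-linear : ∀ l z h → A l (z ⊕ h) ≡ A l z ⊕ A l h
      A-linear l z h = trans
        (cong₂ (line l) (V.take-zipWith ℕ._+_ z h) (V.drop-zipWith {m = n} ℕ._+_ z h))
        (line-⊕ l (V.take n z) (V.take n h) (V.drop n z) (V.drop n h))

    factor-coords : ∀ l x d → factor l (coords (x V.++ d)) ≡ 1ℤ - (onLine l x d - value l) ^ q
    factor-coords l x d = cong₂ (λ y e → 1ℤ - (f (line l y e) - value l) ^ q) (take-coords x d) (drop-coords x d)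

    -- By `fermat`, a nonzero difference from the prescribed value has q-th power 1, which makes its
    -- factor, and with it the product, vanish.
    indicator-elim : ∀ x d → ¬ indicator (coords (x V.++ d)) ≋ 0ℤ → ∀ l → onLine (toℕ l) x d ≋ value (toℕ l)
    indicator-elim x d ind≉0 l with nonzero (onLine (toℕ l) x d - value (toℕ l)) in eq
    ... | false = -≋0⇒≋ (nonzero≡false⇒≋0 eq)
    ... | true  = contradiction (∏<-zero p (Fin.toℕ<n l) (≋-trans (≋-reflexive (factor-coords (toℕ l) x d))
            (≋⇒-≋0 (≋-sym (fermat (nonzero⇒≉0 eq)))))) ind≉0

    indicator-intro : ∀ x d → (∀ {l} → l ℕ.< p → onLine l x d ≋ value l) → ¬ indicator (coords (x V.++ d)) ≋ 0ℤ
    indicator-intro x d h = ∏<-nonzero p λ {l} l<p factor≋0 → 1≉0 (≋-trans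
      (≋-trans (+-cong (≋-refl {1ℤ}) (-‿cong (≋-sym (^q-zero (≋⇒-≋0 (h l<p))))))
        (≋-reflexive (sym (factor-coords l x d)))) factor≋0)

    indicator-zero-v : ¬ indicator (coords (replicate n Fin.zero V.++ v)) ≋ 0ℤ
    indicator-zero-v = indicator-intro (replicate n Fin.zero) v λ {l} l<p → ≋-trans
      (≋-reflexive (trans (cong (λ x → f (line l x (coords v))) (map-toℕ-zeros n)) (f-ray l (coords v))))
      (ray l l<p)
      where
      ray : ∀ l → l ℕ.< p → (+ l) ^ q * c ≋ value l
      ray zero    _   = *-zeroˡ-≋ c (^q-zero ≋-refl)
      ray (suc l) l<p = ≋-trans (*-cong (fermat (small≉0 (s≤s z≤n) l<p)) (≋-refl {c})) (≋-reflexive (ℤ.*-identityˡ c))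

    ∣indicator∣≤lineCount : ∣supp∣ indicator ℕ.≤ lineCount p n (rect12 T₁ T₂)
    ∣indicator∣≤lineCount = ℕ.≤-trans
      (ℕ.≤-reflexive (trans (∣supp∣≡card indicator) (card-pairs n (support indicator))))
      (length-filterᵇ-mono (λ { (x , d) eq → contains-intro {x} {d} (indicator-elim x d (nonzero⇒≉0 eq)) })
        (cartesianProduct (allPts p n) (allPts p n)))

    -- For 2n variables and degree p q² the support bound is p^(2n q) ≤ |supp|^q p^(p q²). With 2n =
    -- e + q p, dividing by p^(p q²) leaves p^(e q) ≤ |supp|^q, and the q-th power is strictly
    -- monotone.
    lineCount-bound : p ℕ.* p ℕ.≤ n → p ℕ.^ (2 ℕ.* n ℕ.+ p ℕ.∸ p ℕ.* p) ℕ.≤ lineCount p n (rect12 T₁ T₂)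
    lineCount-bound p²≤n = ℕ.≤-trans (ℕ.≮⇒≥ λ lt → ℕ.<⇒≱ (ℕ.^-monoˡ-< q {{ℕ.>-nonZero 0<q}} lt) powers) ∣indicator∣≤lineCount
      where
      open ℕ.≤-Reasoning
      e = 2 ℕ.* n ℕ.+ p ℕ.∸ p ℕ.* p
      e+qp : e ℕ.+ q ℕ.* p ≡ n ℕ.+ n
      e+qp = ℕ.+-cancelʳ-≡ p _ _ (begin-equality
        e ℕ.+ q ℕ.* p ℕ.+ p         ≡⟨ ℕ.+-assoc e (q ℕ.* p) p ⟩
        e ℕ.+ (q ℕ.* p ℕ.+ p)       ≡⟨ cong (e ℕ.+_) (ℕ.+-comm (q ℕ.* p) p) ⟩
        -- Since p² ≤ n, the truncated subtraction in `e` is exact.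
        e ℕ.+ p ℕ.* p               ≡⟨ ℕ.m∸n+n≡m (ℕ.≤-trans p²≤n (ℕ.≤-trans (ℕ.m≤m+n n (n ℕ.+ 0)) (ℕ.m≤m+n (2 ℕ.* n) p))) ⟩
        2 ℕ.* n ℕ.+ p               ≡⟨ cong (λ m → n ℕ.+ m ℕ.+ p) (ℕ.+-identityʳ n) ⟩
        n ℕ.+ n ℕ.+ p               ∎)
      powers : (p ℕ.^ e) ℕ.^ q ℕ.≤ ∣supp∣ indicator ℕ.^ q
      powers = ℕ.*-cancelʳ-≤ _ _ (p ℕ.^ (p ℕ.* (q ℕ.* q))) {{ℕ.m^n≢0 p (p ℕ.* (q ℕ.* q))}} (begin
        (p ℕ.^ e) ℕ.^ q ℕ.* p ℕ.^ (p ℕ.* (q ℕ.* q))   ≡⟨ cong (ℕ._* p ℕ.^ (p ℕ.* (q ℕ.* q))) (ℕ.^-*-assoc p e q) ⟩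
        p ℕ.^ (e ℕ.* q) ℕ.* p ℕ.^ (p ℕ.* (q ℕ.* q))   ≡⟨ ℕ.^-distribˡ-+-* p (e ℕ.* q) (p ℕ.* (q ℕ.* q)) ⟨
        p ℕ.^ (e ℕ.* q ℕ.+ p ℕ.* (q ℕ.* q))           ≡⟨ cong (p ℕ.^_) (lem e q p) ⟩
        p ℕ.^ ((e ℕ.+ q ℕ.* p) ℕ.* q)                 ≡⟨ cong (λ m → p ℕ.^ (m ℕ.* q)) e+qp ⟩
        p ℕ.^ ((n ℕ.+ n) ℕ.* q)                       ≤⟨ ∣supp∣-bound (n ℕ.+ n) (p ℕ.* (q ℕ.* q)) deg-indicator
                                                          (∣supp∣-pos indicator (replicate n Fin.zero V.++ v) indicator-zero-v) ⟩
        ∣supp∣ indicator ℕ.^ q ℕ.* p ℕ.^ (p ℕ.* (q ℕ.* q)) ∎)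
        where
        lem : ∀ e q p → e ℕ.* q ℕ.+ p ℕ.* (q ℕ.* q) ≡ (e ℕ.+ q ℕ.* p) ℕ.* q
        lem = solveℕ-∀

open import Data.Nat using (_+_; _*_; _^_; _∸_; _≤_; _<_; NonZero)

theorem3p3 : (p : ℕ) .{{_ : NonZero p}} → Prime p → (n : ℕ) → p * p ≤ n →
    (D : Subset p n) → card p n D < (n + p ∸ 2) C (p ∸ 1) →
    Σ (Subset p n) λ T₁ → Σ (Subset p n) λ T₂ →
    (∀ x → T₁ x ≡ true → T₂ x ≡ false) ×
    p ^ (2 * n + p ∸ p * p) ≤ lineCount p n (rect12 T₁ T₂) ×
    (∀ x d → D d ≡ true → containsLine p (rect12 T₁ T₂) x d ≡ false)
theorem3p3 (suc q) p-prime (suc m) p²≤n D |D|< =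
  from-form (∃-vanishing-form m q ℕ.≤-refl D (subst (card (suc q) (suc m) D <_) C≡dim |D|<))
  where
  open Modulo q p-prime
  open IntegerFunctions using (form; form-homogeneous)
  -- With n = m + 1 and p = q + 1, the upper index n + p - 2 is m + q.
  C≡dim : (suc m + suc q ∸ 2) C q ≡ dim m q
  C≡dim = trans (cong (λ k → (k ∸ 1) C q) (ℕ.+-suc m q)) (sym (dim≡C m q))
  from-form : VanishingForm m q D → _
  from-form (c , vanish , v , fv≉0) =
    T₁ , T₂ , disjoint , lineCount-bound p²≤n , λ x d Dd → no-line x d (vanish d Dd)
    where
    open Lines (form m q c) (deg-form m q c) (form-homogeneous m q c) (form-cong m q c) v fv≉0
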